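{- There is an absolute constant $C>0$ such that for every odd prime $p$ there exist a set $R\subseteq\mathbb{Z}_p$ with $|R|\le C\log p$ and a permutation $\phi$ of $R$ such that $T=\{(r,c,r+c): r\in R,\ c\in\mathbb{Z}_p\}$ is an orthogonal trade in $B_p$ of index $(1,2)$ with disjoint mate $T'=\{(r,c,\phi(r)+c): r\in R,\ c\in\mathbb{Z}_p\}$ (i.e. the trade permutes $O(\log p)$ entire rows of $B_p$).
   Context: All arithmetic is modulo $p$. A Latin square of order $p$ is viewed as a set of (row, column, symbol) triples in $\mathbb{Z}_p^3$. For $1\le k\le p-1$, $B_p(k)$ is the Latin square with symbol $ki+j$ in cell $(i,j)$, $i,j\in\mathbb{Z}_p$; $B_p=B_p(1)$. A Latin trade in a Latin square $L$ is a subset $T\subseteq L$ for which there is a partial Latin square $T'$ (a disjoint mate) such that $T$ and $T'$ occupy the same set of cells, $T\cap T'=\emptyset$, and each row (respectively column) of $T$ contains the same set of symbols as the corresponding row (column) of $T'$. Two Latin squares of order $p$ are orthogonal if superimposing them yields each of the $p^2$ ordered pairs exactly once. An orthogonal trade of index $(\ell,k)$ is a Latin trade $T\subseteq B_p(\ell)$ having a disjoint mate $T'$ such that $(B_p(\ell)\setminus T)\cup T'$ is orthogonal to $B_p(k)$. -}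

module Defs where

open import Data.Fin.Base using (Fin; toℕ)
open import Data.Fin.Subset using (Subset; _∈_)
open import Data.Nat.Base using (ℕ; NonZero; _+_; _*_)
open import Data.Nat.DivMod using (_mod_)
open import Data.Product using (_×_; _,_; ∃; ∃-syntax; Σ-syntax; ∃!; proj₁)
open import Function.Bundles using (_⇔_; _↔_; module Inverse)
open import Level using (0ℓ)
open import Relation.Binary.PropositionalEquality using (_≡_)
open import Relation.Unary using (Pred; _⊆_; _∪_; _∖_; _⊥_)

-- Sets of (row , column , symbol) triples over ℤ/p, whose elements are
-- represented by their residues in Fin p.

Triples : ℕ → Set₁
Triples p = Pred (Fin p × Fin p × Fin p) 0ℓ

record IsPartialLatinSquare {p : ℕ} (P : Triples p) : Set where
  field
    symbol-unique : ∀ {r c s s′} → P (r , c , s) → P (r , c , s′) → s ≡ s′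
    column-unique : ∀ {r s c c′} → P (r , c , s) → P (r , c′ , s) → c ≡ c′
    row-unique    : ∀ {c s r r′} → P (r , c , s) → P (r′ , c , s) → r ≡ r′

record IsLatinSquare {p : ℕ} (L : Triples p) : Set where
  field
    cell       : ∀ r c → ∃! _≡_ λ s → L (r , c , s)
    row-symbol : ∀ r s → ∃! _≡_ λ c → L (r , c , s)
    col-symbol : ∀ c s → ∃! _≡_ λ r → L (r , c , s)

record Orthogonal {p : ℕ} (L M : Triples p) : Set where
  field
    isLatinˡ : IsLatinSquare L
    isLatinʳ : IsLatinSquare M
    pairs    : ∀ s t → ∃! _≡_ λ ((r , c) : Fin p × Fin p) →
                 L (r , c , s) × M (r , c , t)

-- The Latin square with symbol k i + j (mod p) in cell (i , j).

B : (p : ℕ) .{{_ : NonZero p}} → ℕ → Triples p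
B p k (i , j , s) = s ≡ (k * toℕ i + toℕ j) mod p

record IsDisjointMate {p : ℕ} (T T′ : Triples p) : Set where
  field
    isPartialLatin : IsPartialLatinSquare T′
    same-cells     : ∀ r c → (∃[ s ] T (r , c , s)) ⇔ (∃[ s ] T′ (r , c , s))
    disjoint       : T ⊥ T′
    same-rows      : ∀ r s → (∃[ c ] T (r , c , s)) ⇔ (∃[ c ] T′ (r , c , s))
    same-columns   : ∀ c s → (∃[ r ] T (r , c , s)) ⇔ (∃[ r ] T′ (r , c , s))

-- T is a Latin trade in L with disjoint mate T′.  The empty set is not excluded
-- here, so nonemptiness has to be required separately.

record IsLatinTrade {p : ℕ} (L T T′ : Triples p) : Set where
  field
    sub  : T ⊆ L
    mate : IsDisjointMate T T′

record IsOrthogonalTrade (p : ℕ) .{{_ : NonZero p}} (ℓ k : ℕ)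
                         (T T′ : Triples p) : Set where
  field
    isLatinTrade : IsLatinTrade (B p ℓ) T T′
    orthogonal   : Orthogonal ((B p ℓ ∖ T) ∪ T′) (B p k)

infixl 6 _⊕_

_⊕_ : ∀ {p} .{{_ : NonZero p}} → Fin p → Fin p → Fin p
_⊕_ {p} a b = (toℕ a + toℕ b) mod p

Elements : ∀ {p} → Subset p → Set
Elements R = ∃ (_∈ R)

PermutationOf : ∀ {p} → Subset p → Set
PermutationOf R = Elements R ↔ Elements R

-- The triples (r , c , r + c) with r ∈ R.

rows : ∀ {p} .{{_ : NonZero p}} → Subset p → Triples p
rows R (r , c , s) = r ∈ R × s ≡ r ⊕ c

-- The triples (r , c , φ r + c) with r ∈ R.

permutedRows : ∀ {p} .{{_ : NonZero p}} (R : Subset p) → PermutationOf R → Triples p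
permutedRows R φ (r , c , s) =
  Σ[ r∈R ∈ r ∈ R ] s ≡ proj₁ (Inverse.to φ (r , r∈R)) ⊕ c

{-# OPTIONS --safe #-}
module Submission where

-- Let σ permute ℤ/p.  Replacing row r of B_p by row σ r gives a square orthogonal to B_p(2) iff
-- r ↦ 2r − σ r is a permutation too.  So it suffices to find a digraph on O(log p) residues with
-- in- and out-degree 2 in which every vertex is the midpoint of its two successors.
--
-- It is grown around 0 in stages.  In stage n all vertices lie strictly between −n and n and
-- avoid 0, and the degrees are right except that 1 and −1 lack an incoming edge while two edges
-- lead to n and −n instead.  If 2n + 1 = p, the vertices 0, n and −n close the digraph modulo p.
-- Rescaling stage m by an affine map and adding at most five vertices yields stage n for
-- n = 3m, 4m ± 1 and 6m ± 2, which reaches every n ≥ 3 from a few small stages and takes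
-- O(log n) steps.

open import Defs

open import Algebra.Properties.AbelianGroup using (∙-cancelʳ)
open import Data.Bool.Base using (T; true; false; not)
open import Data.Fin.Base using (Fin; toℕ; fromℕ<)
open import Data.Fin.Patterns
open import Data.Fin.Permutation using (Permutation′; permutation; _⟨$⟩ʳ_; _⟨$⟩ˡ_; inverseˡ; inverseʳ)
open import Data.Fin.Properties using (_≟_; toℕ-injective; toℕ-fromℕ<; toℕ<n)
import Data.Fin.Subset as Subset
open import Data.Fin.Subset using (Subset; Nonempty; ⋃; ⁅_⁆)
open import Data.Fin.Subset.Properties using (x∈⁅x⁆; p⊆p∪q; q⊆p∪q; p⊆q⇒∣p∣≤∣q∣; ∣⊥∣≡0; ∣⁅x⁆∣≡1)
open import Data.Integer.Base
  using (ℤ; +_; -_; ∣_∣; _+_; _*_; _-_; 0ℤ; 1ℤ; -1ℤ; _/ℕ_; _%ℕ_; ≢-nonZero)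
open import Data.Integer.DivMod using (n%ℕd<d; a≡a%ℕn+[a/ℕn]*n)
import Data.Integer.Properties as ℤ
open import Data.Integer.Tactic.RingSolver using (solve-∀)
open import Data.List.Base using (List; []; _∷_; _++_; map; length)
import Data.List.Membership.DecPropositional as DecMembership
open import Data.List.Membership.Propositional using (_∈_; _∉_; find)
open import Data.List.Membership.Propositional.Properties using (∈-map⁺; ∈-map⁻)
open import Data.List.Properties using (map-++; length-++; length-map)
open import Data.List.Relation.Binary.Permutation.Propositional
  using (_↭_; prep; ↭-refl; ↭-sym; ↭-trans; ↭⇒↭ₛ; module PermutationReasoning)
open import Data.List.Relation.Binary.Permutation.Propositional.Properties
  using (∈-resp-↭; All-resp-↭; map⁺; ++⁺ˡ; ++⁺ʳ; shift; drop-∷)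
import Data.List.Relation.Binary.Permutation.Setoid.Properties as ↭ₛ
open import Data.List.Relation.Unary.All as All using (All; []; _∷_)
import Data.List.Relation.Unary.All.Properties as All
open import Data.List.Relation.Unary.AllPairs using ([]; _∷_)
open import Data.List.Relation.Unary.Any using (Any; here; there)
import Data.List.Relation.Unary.Unique.DecPropositional as DecUnique
open import Data.List.Relation.Unary.Unique.Propositional using (Unique)
import Data.List.Relation.Unary.Unique.Propositional.Properties as Unique
open import Data.Maybe using (Maybe; just; nothing; is-just; to-witness-T; _>>=_)
open import Data.Nat.Base as ℕ using (ℕ; zero; suc; z≤n; s≤s; NonZero; _≤_; _>_)
open import Data.Nat.Divisibility using (_∤_; divides)
open import Data.Nat.DivMod using (DivMod; result; _divMod_; _mod_)
open import Data.Nat.Induction using (<-rec)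
open import Data.Nat.Logarithm using (⌊log₂_⌋; ⌊log₂⌋-mono-≤; ⌊log₂[2*b]⌋≡1+⌊log₂b⌋)
open import Data.Nat.Primality using (Prime; ¬prime[1])
import Data.Nat.Properties as ℕ
import Data.Nat.Tactic.RingSolver as ℕ-Solver
open import Data.Product using (_×_; _,_; Σ-syntax; ∃-syntax; ∃; proj₁)
open import Data.Sum using (_⊎_; inj₁; inj₂)
open import Data.Vec.Base using ([]; _∷_; tabulate)
open import Data.Vec.Properties using (lookup∘tabulate; []=⇒lookup; lookup⇒[]=)
open import Data.Vec.Properties.WithK using ([]=-irrelevant)
open import Function.Bundles using (_⇔_; mk⇔; mk↔ₛ′; module Equivalence; module Inverse)
open import Relation.Binary.Definitions using (DecidableEquality)
open import Relation.Binary.PropositionalEquality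
open import Relation.Nullary using (does; yes; no; contradiction)
open import Relation.Nullary.Decidable
  using (Dec; True; toWitness; from-yes; dec-true; dec-false; ¬?; _×-dec_)
open import Relation.Unary using (_∪_; _∖_)

-- Congruence of integers and arithmetic on residues.

module _ {p : ℕ} .{{_ : NonZero p}} where

  infix 4 _≈_
  infixr 4 _,_

  -- The quotient is kept as data, so a congruence is proved by naming its quotient and checking a
  -- ring identity.
  record _≈_ (i j : ℤ) : Set where
    constructor _,_
    field
      quotient : ℤ
      equality : i ≡ j + quotient * + p

  ≈-sym : ∀ {i j} → i ≈ j → j ≈ i
  ≈-sym {i} {j} (k , refl) = - k , eq j k (+ p)
    where
    eq : ∀ j k n → j ≡ (j + k * n) + - k * n
    eq = solve-∀

  ≈-trans : ∀ {i j k} → i ≈ j → j ≈ k → i ≈ k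
  ≈-trans {k = k} (a , refl) (b , refl) = b + a , eq k a b (+ p)
    where
    eq : ∀ k a b n → (k + b * n) + a * n ≡ k + (b + a) * n
    eq = solve-∀

  ≈-+ : ∀ {i j k l} → i ≈ j → k ≈ l → i + k ≈ j + l
  ≈-+ {j = j} {l = l} (a , refl) (b , refl) = a + b , eq j l a b (+ p)
    where
    eq : ∀ j l a b n → (j + a * n) + (l + b * n) ≡ (j + l) + (a + b) * n
    eq = solve-∀

  ≈-*ˡ : ∀ k {i j} → i ≈ j → k * i ≈ k * j
  ≈-*ˡ k {j = j} (a , refl) = k * a , eq k j a (+ p)
    where
    eq : ∀ k j a n → k * (j + a * n) ≡ k * j + (k * a) * n
    eq = solve-∀

  ≡⇒≈ : ∀ {i j} → i ≡ j → i ≈ j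
  ≡⇒≈ {i} refl = 0ℤ , eq i (+ p)
    where
    eq : ∀ i n → i ≡ i + 0ℤ * n
    eq = solve-∀

  -- The difference is `k * p`, and ∣k∣p < p forces `k` to be 0.
  ≈-small : ∀ {i j} → i ≈ j → ∣ i - j ∣ ℕ.< p → i ≡ j
  ≈-small {i} {j} (k , refl) small = trans (cong (λ k → j + k * + p) k≡0) (eq₂ j (+ p))
    where
    eq₁ : ∀ j k n → (j + k * n) - j ≡ k * n
    eq₁ = solve-∀
    eq₂ : ∀ j n → j + 0ℤ * n ≡ j
    eq₂ = solve-∀
    ∣k∣p<p : ∣ k ∣ ℕ.* p ℕ.< 1 ℕ.* p
    ∣k∣p<p = subst₂ ℕ._<_
      (trans (cong ∣_∣ (eq₁ j k (+ p))) (ℤ.∣i*j∣≡∣i∣*∣j∣ k (+ p))) (sym (ℕ.*-identityˡ p)) small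
    k≡0 : k ≡ 0ℤ
    k≡0 = ℤ.∣i∣≡0⇒i≡0 (ℕ.n<1⇒n≡0 (ℕ.*-cancelʳ-< p ∣ k ∣ 1 ∣k∣p<p))

  ι : Fin p → ℤ
  ι a = + toℕ a

  residue : ℤ → Fin p
  residue i = fromℕ< (n%ℕd<d i p)

  ι-residue : ∀ i → ι (residue i) ≈ i
  ι-residue i = - (i /ℕ p) ,
    trans (cong +_ (toℕ-fromℕ< (n%ℕd<d i p)))
      (trans (eq (+ (i %ℕ p)) (i /ℕ p) (+ p))
        (cong (_+ - (i /ℕ p) * + p) (sym (a≡a%ℕn+[a/ℕn]*n i p))))
    where
    eq : ∀ r q n → r ≡ (r + q * n) + - q * n
    eq = solve-∀

  ι-injective : ∀ {a b} → ι a ≈ ι b → a ≡ b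
  ι-injective {a} {b} a≈b = toℕ-injective (ℤ.+-injective (≈-small a≈b ∣a-b∣<p))
    where
    ∣a-b∣<p : ∣ ι a - ι b ∣ ℕ.< p
    ∣a-b∣<p = ℕ.≤-<-trans
      (subst (λ i → ∣ i ∣ ℕ.≤ toℕ a ℕ.⊔ toℕ b) (sym (ℤ.m-n≡m⊖n (toℕ a) (toℕ b)))
        (ℤ.∣m⊝n∣≤m⊔n (toℕ a) (toℕ b)))
      (ℕ.⊔-pres-<m (toℕ<n a) (toℕ<n b))

  residue-cong : ∀ {i j} → i ≈ j → residue i ≡ residue j
  residue-cong {i} {j} i≈j =
    ι-injective (≈-trans (ι-residue i) (≈-trans i≈j (≈-sym (ι-residue j))))

  residue-injective : ∀ {i j} → residue i ≡ residue j → i ≈ j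
  residue-injective {i} {j} eq =
    ≈-trans (≈-sym (ι-residue i)) (≈-trans (≡⇒≈ (cong ι eq)) (ι-residue j))

  -- On nonnegative integers `residue` computes to `_mod_`, so `a ⊕ b` is `residue (ι a + ι b)` by
  -- definition.
  ι-⊕ : ∀ a b → ι (a ⊕ b) ≈ ι a + ι b
  ι-⊕ a b = ι-residue (ι a + ι b)

  residue-⊕ : ∀ i j → residue i ⊕ residue j ≡ residue (i + j)
  residue-⊕ i j = residue-cong (≈-+ (ι-residue i) (ι-residue j))

  ⊕-comm : ∀ a b → a ⊕ b ≡ b ⊕ a
  ⊕-comm a b = residue-cong (≡⇒≈ (ℤ.+-comm (ι a) (ι b)))

  ⊕-assoc : ∀ a b c → (a ⊕ b) ⊕ c ≡ a ⊕ (b ⊕ c)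
  ⊕-assoc a b c = residue-cong
    (≈-trans (≈-+ (ι-⊕ a b) (≡⇒≈ {ι c} refl))
      (≈-trans (≡⇒≈ (ℤ.+-assoc (ι a) (ι b) (ι c))) (≈-+ (≡⇒≈ {ι a} refl) (≈-sym (ι-⊕ b c)))))

  infixl 6 _⊝_

  _⊝_ : Fin p → Fin p → Fin p
  a ⊝ b = residue (ι a - ι b)

  a⊕[b⊝a]≡b : ∀ a b → a ⊕ (b ⊝ a) ≡ b
  a⊕[b⊝a]≡b a b = ι-injective
    (≈-trans (ι-⊕ a (b ⊝ a))
      (≈-trans (≈-+ (≡⇒≈ {ι a} refl) (ι-residue (ι b - ι a))) (≡⇒≈ (eq (ι a) (ι b)))))
    where
    eq : ∀ a b → a + (b - a) ≡ b
    eq = solve-∀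

  ⊕-cancelˡ : ∀ a {b c} → a ⊕ b ≡ a ⊕ c → b ≡ c
  ⊕-cancelˡ a {b} {c} eq = ι-injective
    (≈-trans (≡⇒≈ (eq′ (ι a) (ι b)))
      (≈-trans (≈-+ (residue-injective {ι a + ι b} {ι a + ι c} eq) (≡⇒≈ { - ι a} refl))
        (≡⇒≈ (sym (eq′ (ι a) (ι c))))))
    where
    eq′ : ∀ a b → b ≡ (a + b) + - a
    eq′ = solve-∀

  ⊕-cancelʳ : ∀ a {b c} → b ⊕ a ≡ c ⊕ a → b ≡ c
  ⊕-cancelʳ a {b} {c} eq = ⊕-cancelˡ a (trans (⊕-comm a b) (trans eq (⊕-comm c a)))

  module _ (k : ℕ) (p+1≡2k : + p + + 1 ≡ + 2 * + k) where

    -- Since 2k = p + 1, multiplication by `k` inverts doubling; this is the form in which oddness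
    -- of p enters.
    half : Fin p → Fin p
    half a = residue (+ k * ι a)

    half-double : ∀ a → half (a ⊕ a) ≡ a
    half-double a = ι-injective (≈-trans (ι-residue (+ k * ι (a ⊕ a)))
      (≈-trans (≈-*ˡ (+ k) (ι-⊕ a a)) (ι a , trans (eq₁ (+ k) (ι a))
        (trans (cong (_* ι a) (sym p+1≡2k)) (eq₂ (+ p) (ι a))))))
      where
      eq₁ : ∀ k a → k * (a + a) ≡ (+ 2 * k) * a
      eq₁ = solve-∀
      eq₂ : ∀ p a → (p + + 1) * a ≡ a + a * p
      eq₂ = solve-∀

    double-half : ∀ a → half a ⊕ half a ≡ a
    double-half a = ι-injective (≈-trans (ι-⊕ (half a) (half a))
      (≈-trans (≈-+ (ι-residue (+ k * ι a)) (ι-residue (+ k * ι a)))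
        (ι a , trans (eq₁ (+ k) (ι a)) (trans (cong (_* ι a) (sym p+1≡2k)) (eq₂ (+ p) (ι a))))))
      where
      eq₁ : ∀ k a → k * a + k * a ≡ (+ 2 * k) * a
      eq₁ = solve-∀
      eq₂ : ∀ p a → (p + + 1) * a ≡ a + a * p
      eq₂ = solve-∀

  B1-⊕ : ∀ i j → (1 ℕ.* toℕ i ℕ.+ toℕ j) mod p ≡ i ⊕ j
  B1-⊕ i j = cong (λ k → (k ℕ.+ toℕ j) mod p) (ℕ.*-identityˡ (toℕ i))

  B2-⊕ : ∀ i j → (2 ℕ.* toℕ i ℕ.+ toℕ j) mod p ≡ (i ⊕ i) ⊕ j
  B2-⊕ i j = residue-cong {+ (2 ℕ.* toℕ i ℕ.+ toℕ j)}
    (≈-trans (≡⇒≈ (cong (λ k → + (toℕ i ℕ.+ k ℕ.+ toℕ j)) (ℕ.+-identityʳ (toℕ i))))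
      (≈-+ (≈-sym (ι-⊕ i i)) (≡⇒≈ {ι j} refl)))

-- From a pair of permutations with σ r + τ r = 2r to an orthogonal trade.

module Trade {p : ℕ} .{{_ : NonZero p}} (k : ℕ) (p+1≡2k : + p + + 1 ≡ + 2 * + k)
             (σ τ : Permutation′ p)
             (balanced : ∀ r → (σ ⟨$⟩ʳ r) ⊕ (τ ⟨$⟩ʳ r) ≡ r ⊕ r) where

  -- Only the moved rows are traded: a row fixed by `σ` would lie in both the trade and its mate.
  support : Subset p
  support = tabulate λ r → not (does ((σ ⟨$⟩ʳ r) ≟ r))

  moved⇒∈support : ∀ {r} → σ ⟨$⟩ʳ r ≢ r → r Subset.∈ support
  moved⇒∈support {r} σr≢r = lookup⇒[]= r support
    (trans (lookup∘tabulate _ r) (cong not (dec-false ((σ ⟨$⟩ʳ r) ≟ r) σr≢r)))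

  ∈support⇒moved : ∀ {r} → r Subset.∈ support → σ ⟨$⟩ʳ r ≢ r
  ∈support⇒moved {r} r∈ σr≡r
    with () ← trans (sym (trans (sym (lookup∘tabulate _ r)) ([]=⇒lookup r∈)))
                    (cong not (dec-true ((σ ⟨$⟩ʳ r) ≟ r) σr≡r))

  elements-≡ : ∀ {x y : Elements support} → proj₁ x ≡ proj₁ y → x ≡ y
  elements-≡ {r , r∈} {.r , r∈′} refl = cong (r ,_) ([]=-irrelevant r∈ r∈′)

  φ : PermutationOf support
  φ = mk↔ₛ′
    (λ (r , r∈) → σ ⟨$⟩ʳ r , moved⇒∈support λ eq → ∈support⇒moved r∈
      (trans (sym (inverseˡ σ)) (trans (cong (σ ⟨$⟩ˡ_) eq) (inverseˡ σ))))
    (λ (r , r∈) → σ ⟨$⟩ˡ r , moved⇒∈support λ eq → ∈support⇒moved r∈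
      (trans (cong (σ ⟨$⟩ʳ_) (trans (sym (inverseʳ σ)) eq)) (inverseʳ σ)))
    (λ _ → elements-≡ (inverseʳ σ))
    (λ _ → elements-≡ (inverseˡ σ))

  trade mate : Triples p
  trade = rows support
  mate  = permutedRows support φ

  B2-symbol : ∀ r c s → B p 2 (r , c , s) ⇔ s ≡ (r ⊕ r) ⊕ c
  B2-symbol r c s = mk⇔ (λ s≡ → trans s≡ (B2-⊕ r c)) (λ s≡ → trans s≡ (sym (B2-⊕ r c)))

  -- In a fixed row the old symbol r + c already agrees with σ r + c, so one formula describes the
  -- switched square in all rows.
  switched-symbol : ∀ r c s → ((B p 1 ∖ trade) ∪ mate) (r , c , s) ⇔ s ≡ (σ ⟨$⟩ʳ r) ⊕ c
  switched-symbol r c s = mk⇔ to from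
    where
    to : ((B p 1 ∖ trade) ∪ mate) (r , c , s) → s ≡ (σ ⟨$⟩ʳ r) ⊕ c
    to (inj₂ (_ , s≡)) = s≡
    to (inj₁ (b , ∉trade)) with (σ ⟨$⟩ʳ r) ≟ r
    ... | yes σr≡r = trans (trans b (B1-⊕ r c)) (cong (_⊕ c) (sym σr≡r))
    ... | no  σr≢r = contradiction (moved⇒∈support σr≢r , trans b (B1-⊕ r c)) ∉trade
    from : s ≡ (σ ⟨$⟩ʳ r) ⊕ c → ((B p 1 ∖ trade) ∪ mate) (r , c , s)
    from s≡ with (σ ⟨$⟩ʳ r) ≟ r
    ... | yes σr≡r = inj₁ (trans s≡ (trans (cong (_⊕ c) σr≡r) (sym (B1-⊕ r c)))
                          , λ (r∈ , _) → ∈support⇒moved r∈ σr≡r)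
    ... | no  σr≢r = inj₂ (moved⇒∈support σr≢r , s≡)

  σ-injective : ∀ {r r′} → σ ⟨$⟩ʳ r ≡ σ ⟨$⟩ʳ r′ → r ≡ r′
  σ-injective eq = trans (sym (inverseˡ σ)) (trans (cong (σ ⟨$⟩ˡ_) eq) (inverseˡ σ))

  -- The addition table with its rows permuted is Latin. Both squares of the orthogonal pair have
  -- this shape, `ρ` being `σ` for one and `doubling` for the other.
  translates-latin : (ρ : Permutation′ p) (L : Triples p) →
                     (∀ r c s → L (r , c , s) ⇔ s ≡ (ρ ⟨$⟩ʳ r) ⊕ c) → IsLatinSquare L
  translates-latin ρ L L⇔ = record
    { cell       = λ r c → (ρ ⟨$⟩ʳ r) ⊕ c , from refl , λ l → sym (to l)
    ; row-symbol = λ r s → s ⊝ (ρ ⟨$⟩ʳ r) , from (sym (a⊕[b⊝a]≡b (ρ ⟨$⟩ʳ r) s))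
                 , λ l → ⊕-cancelˡ (ρ ⟨$⟩ʳ r) (trans (a⊕[b⊝a]≡b (ρ ⟨$⟩ʳ r) s) (to l))
    ; col-symbol = λ c s → ρ ⟨$⟩ˡ (s ⊝ c)
                 , from (sym (trans (cong (_⊕ c) (inverseʳ ρ)) (trans (⊕-comm (s ⊝ c) c) (a⊕[b⊝a]≡b c s))))
                 , λ {r} l → trans (cong (ρ ⟨$⟩ˡ_) (⊕-cancelˡ c
                     (trans (a⊕[b⊝a]≡b c s) (trans (to l) (⊕-comm (ρ ⟨$⟩ʳ r) c))))) (inverseˡ ρ)
    }
    where
    to : ∀ {r c s} → L (r , c , s) → s ≡ (ρ ⟨$⟩ʳ r) ⊕ c
    to = Equivalence.to (L⇔ _ _ _)
    from : ∀ {r c s} → s ≡ (ρ ⟨$⟩ʳ r) ⊕ c → L (r , c , s)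
    from = Equivalence.from (L⇔ _ _ _)

  doubling : Permutation′ p
  doubling = mk↔ₛ′ (λ r → r ⊕ r) (half k p+1≡2k) (double-half k p+1≡2k) (half-double k p+1≡2k)

  -- From s = σ r + c and t = 2r + c one gets t - s = τ r. Hence r is recovered by inverting `τ`,
  -- and then c = s - σ r.
  orthogonal : Orthogonal ((B p 1 ∖ trade) ∪ mate) (B p 2)
  orthogonal = record
    { isLatinˡ = translates-latin σ _ switched-symbol
    ; isLatinʳ = translates-latin doubling _ B2-symbol
    ; pairs    = λ s t →
        let r = τ ⟨$⟩ˡ (t ⊝ s) ; c = s ⊝ (σ ⟨$⟩ʳ r)
            σr⊕c≡s = a⊕[b⊝a]≡b (σ ⟨$⟩ʳ r) s
        in (r , c)
         , ( Equivalence.from (switched-symbol r c s) (sym σr⊕c≡s)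
           , Equivalence.from (B2-symbol r c t) (sym (trans (double⊕ r c)
               (trans (cong₂ _⊕_ (inverseʳ τ) σr⊕c≡s)
                 (trans (⊕-comm (t ⊝ s) s) (a⊕[b⊝a]≡b s t))))))
         , λ { {r′ , c′} (l , m) →
             let s≡ = Equivalence.to (switched-symbol r′ c′ s) l
                 τr′≡ : τ ⟨$⟩ʳ r′ ≡ t ⊝ s
                 τr′≡ = ⊕-cancelˡ s (trans (trans (⊕-comm s (τ ⟨$⟩ʳ r′)) (trans (cong ((τ ⟨$⟩ʳ r′) ⊕_) s≡)
                          (trans (sym (double⊕ r′ c′)) (sym (Equivalence.to (B2-symbol r′ c′ t) m)))))
                          (sym (a⊕[b⊝a]≡b s t)))
                 r≡r′ : r ≡ r′
                 r≡r′ = trans (cong (τ ⟨$⟩ˡ_) (sym τr′≡)) (inverseˡ τ)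
             in cong₂ _,_ r≡r′ (⊕-cancelˡ (σ ⟨$⟩ʳ r)
                  (trans σr⊕c≡s (trans s≡ (cong (λ x → (σ ⟨$⟩ʳ x) ⊕ c′) (sym r≡r′))))) }
    }
    where
    double⊕ : ∀ r c → (r ⊕ r) ⊕ c ≡ (τ ⟨$⟩ʳ r) ⊕ ((σ ⟨$⟩ʳ r) ⊕ c)
    double⊕ r c = trans (cong (_⊕ c) (trans (sym (balanced r)) (⊕-comm (σ ⟨$⟩ʳ r) (τ ⟨$⟩ʳ r))))
                    (⊕-assoc (τ ⟨$⟩ʳ r) (σ ⟨$⟩ʳ r) c)

  -- Every traded row contains all symbols before and after. Column c carries the translate of the
  -- support by c both times, because `σ` permutes its support. A common triple would lie in a fixed
  -- row.
  disjointMate : IsDisjointMate trade mate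
  disjointMate = record
    { isPartialLatin = record
      { symbol-unique = λ t t′ → trans (symbol t) (sym (symbol t′))
      ; column-unique = λ {r} t t′ → ⊕-cancelˡ (σ ⟨$⟩ʳ r) (trans (sym (symbol t)) (symbol t′))
      ; row-unique    = λ {c} t t′ →
          σ-injective (⊕-cancelʳ c (trans (sym (symbol t)) (symbol t′)))
      }
    ; same-cells   = λ r c → mk⇔ (λ (_ , r∈ , _) → _ , r∈ , refl) (λ (_ , r∈ , _) → _ , r∈ , refl)
    ; disjoint     = λ { {r , c , s} ((r∈ , s≡) , t) →
        ∈support⇒moved r∈ (⊕-cancelʳ c (trans (sym (symbol t)) s≡)) }
    ; same-rows    = λ r s → mk⇔
        (λ (_ , r∈ , _) → s ⊝ (σ ⟨$⟩ʳ r) , r∈ , sym (a⊕[b⊝a]≡b (σ ⟨$⟩ʳ r) s))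
        (λ (_ , r∈ , _) → s ⊝ r , r∈ , sym (a⊕[b⊝a]≡b r s))
    ; same-columns = λ c s → mk⇔
        (λ (r , r∈ , s≡) → let (r′ , r′∈) = Inverse.from φ (r , r∈) in
          r′ , r′∈ , trans s≡ (cong (_⊕ c) (sym (inverseʳ σ))))
        (λ (r , r∈ , s≡) → let (r′ , r′∈) = Inverse.to φ (r , r∈) in r′ , r′∈ , s≡)
    }
    where
    symbol : ∀ {r c s} → mate (r , c , s) → s ≡ (σ ⟨$⟩ʳ r) ⊕ c
    symbol (_ , s≡) = s≡

  isOrthogonalTrade : IsOrthogonalTrade p 1 2 (rows support) (permutedRows support φ)
  isOrthogonalTrade = record
    { isLatinTrade = record
      { sub  = λ { {r , c , s} (_ , s≡) → trans s≡ (sym (B1-⊕ r c)) }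
      ; mate = disjointMate
      }
    ; orthogonal = orthogonal
    }

-- From a finite digraph to a pair of permutations.

-- The two successors are ordered because the first edges will make up `σ` and the second edges `τ`.
record Vertex (A : Set) : Set where
  constructor vertex
  field
    at out₁ out₂ : A

open Vertex public

Unique-resp-↭ : ∀ {A : Set} {xs ys : List A} → xs ↭ ys → Unique xs → Unique ys
Unique-resp-↭ xs↭ys = ↭ₛ.Unique-resp-↭ (setoid _) (↭⇒↭ₛ xs↭ys)

∣p∪q∣≤∣p∣+∣q∣ : ∀ {n} (p q : Subset n) → Subset.∣ p Subset.∪ q ∣ ≤ Subset.∣ p ∣ ℕ.+ Subset.∣ q ∣
∣p∪q∣≤∣p∣+∣q∣ []          []          = z≤n
∣p∪q∣≤∣p∣+∣q∣ (true  ∷ p) (true  ∷ q) =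
  s≤s (ℕ.≤-trans (∣p∪q∣≤∣p∣+∣q∣ p q) (ℕ.+-monoʳ-≤ Subset.∣ p ∣ (ℕ.n≤1+n Subset.∣ q ∣)))
∣p∪q∣≤∣p∣+∣q∣ (true  ∷ p) (false ∷ q) = s≤s (∣p∪q∣≤∣p∣+∣q∣ p q)
∣p∪q∣≤∣p∣+∣q∣ (false ∷ p) (true  ∷ q) =
  ℕ.≤-trans (s≤s (∣p∪q∣≤∣p∣+∣q∣ p q)) (ℕ.≤-reflexive (sym (ℕ.+-suc Subset.∣ p ∣ Subset.∣ q ∣)))
∣p∪q∣≤∣p∣+∣q∣ (false ∷ p) (false ∷ q) = ∣p∪q∣≤∣p∣+∣q∣ p q

module _ {p : ℕ} where

  open DecMembership (_≟_ {p}) using (_∈?_)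

  private
    V = Vertex (Fin p)

  -- Unlisted points are fixed, so a permutation of the listed points extends to all residues. With
  -- both projections as parameters, the inverse is the same function with their roles exchanged.
  redirect : (from to : V → Fin p) → List V → Fin p → Fin p
  redirect from to []       x = x
  redirect from to (v ∷ vs) x with x ≟ from v
  ... | yes _ = to v
  ... | no  _ = redirect from to vs x

  redirect-∈ : ∀ from to {vs v} → Unique (map from vs) → v ∈ vs →
               redirect from to vs (from v) ≡ to v
  redirect-∈ from to {w ∷ vs} {v} (w∉ ∷ !vs) v∈ with from v ≟ from w | v∈
  ... | yes _     | here refl = refl
  ... | yes fv≡fw | there v∈vs =
    contradiction (sym fv≡fw) (All.lookup w∉ (∈-map⁺ from v∈vs))
  ... | no  fv≢fv | here refl = contradiction refl fv≢fv
  ... | no  _     | there v∈vs = redirect-∈ from to !vs v∈vs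

  redirect-∉ : ∀ from to {vs x} → x ∉ map from vs → redirect from to vs x ≡ x
  redirect-∉ from to {[]}     x∉ = refl
  redirect-∉ from to {w ∷ vs} {x} x∉ with x ≟ from w
  ... | yes x≡ = contradiction (here x≡) x∉
  ... | no  _  = redirect-∉ from to (λ x∈ → x∉ (there x∈))

  redirect-inverse : ∀ from to {vs} → Unique (map from vs) → map from vs ↭ map to vs →
                     ∀ x → redirect to from vs (redirect from to vs x) ≡ x
  redirect-inverse from to {vs} !from from↭to x with x ∈? map from vs
  ... | no  x∉ = trans (cong (redirect to from vs) (redirect-∉ from to x∉))
                   (redirect-∉ to from λ x∈ → x∉ (∈-resp-↭ (↭-sym from↭to) x∈))
  ... | yes x∈ with v , v∈ , refl ← ∈-map⁻ from x∈ =
    trans (cong (redirect to from vs) (redirect-∈ from to !from v∈))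
      (redirect-∈ to from (Unique-resp-↭ from↭to !from) v∈)

  redirection : ∀ to {vs} → Unique (map at vs) → map at vs ↭ map to vs → Permutation′ p
  redirection to {vs} !at at↭to = permutation (redirect at to vs) (redirect to at vs)
    (redirect-inverse to at (Unique-resp-↭ at↭to !at) (↭-sym at↭to)) (redirect-inverse at to !at at↭to)

  ∣⋃⁅at⁆∣≤length : ∀ (vs : List V) → Subset.∣ ⋃ (map (λ v → ⁅ at v ⁆) vs) ∣ ≤ length vs
  ∣⋃⁅at⁆∣≤length []       = ℕ.≤-reflexive (∣⊥∣≡0 p)
  ∣⋃⁅at⁆∣≤length (v ∷ vs) = ℕ.≤-trans (∣p∪q∣≤∣p∣+∣q∣ ⁅ at v ⁆ _)
    (ℕ.+-mono-≤ (ℕ.≤-reflexive (∣⁅x⁆∣≡1 (at v))) (∣⋃⁅at⁆∣≤length vs))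

  ∈⇒∈⋃ : ∀ {x} (vs : List V) → x ∈ map at vs → x Subset.∈ ⋃ (map (λ v → ⁅ at v ⁆) vs)
  ∈⇒∈⋃ (v ∷ vs) (here refl) = p⊆p∪q _ (x∈⁅x⁆ (at v))
  ∈⇒∈⋃ (v ∷ vs) (there x∈)  = q⊆p∪q ⁅ at v ⁆ _ (∈⇒∈⋃ vs x∈)

module _ {p : ℕ} .{{_ : NonZero p}} (k : ℕ) (p+1≡2k : + p + + 1 ≡ + 2 * + k)
         (vs : List (Vertex (Fin p)))
         (!at : Unique (map at vs))
         (at↭out₁ : map at vs ↭ map out₁ vs)
         (at↭out₂ : map at vs ↭ map out₂ vs)
         (balanced : All (λ v → out₁ v ⊕ out₂ v ≡ at v ⊕ at v) vs)
         (moving : Any (λ v → out₁ v ≢ at v) vs) where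

  open DecMembership (_≟_ {p}) using (_∈?_)

  private
    σ τ : Permutation′ p
    σ = redirection out₁ !at at↭out₁
    τ = redirection out₂ !at at↭out₂

    σ⊕τ : ∀ r → (σ ⟨$⟩ʳ r) ⊕ (τ ⟨$⟩ʳ r) ≡ r ⊕ r
    σ⊕τ r with r ∈? map at vs
    ... | no  r∉ = cong₂ _⊕_ (redirect-∉ at out₁ r∉) (redirect-∉ at out₂ r∉)
    ... | yes r∈ with v , v∈ , refl ← ∈-map⁻ at r∈ =
      trans (cong₂ _⊕_ (redirect-∈ at out₁ !at v∈) (redirect-∈ at out₂ !at v∈))
        (All.lookup balanced v∈)

    open Trade k p+1≡2k σ τ σ⊕τ

    nonempty : Nonempty support
    nonempty with v , v∈ , out≢ ← find moving =
      at v , moved⇒∈support λ eq → out≢ (trans (sym (redirect-∈ at out₁ !at v∈)) eq)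

  orthogonalTrade : Σ[ R ∈ Subset p ] Σ[ φ ∈ PermutationOf R ]
                      Nonempty R × Subset.∣ R ∣ ≤ length vs ×
                      IsOrthogonalTrade p 1 2 (rows R) (permutedRows R φ)
  orthogonalTrade = support , φ , nonempty , ℕ.≤-trans (p⊆q⇒∣p∣≤∣q∣ support⊆) (∣⋃⁅at⁆∣≤length vs)
                  , isOrthogonalTrade
    where
    -- Unlisted points are fixed, so the support lies in a union of `length vs` singletons.
    support⊆ : support Subset.⊆ ⋃ (map (λ v → ⁅ at v ⁆) vs)
    support⊆ {r} r∈ with r ∈? map at vs
    ... | yes r∈vs = ∈⇒∈⋃ vs r∈vs
    ... | no  r∉vs = contradiction (redirect-∉ at out₁ r∉vs) (∈support⇒moved r∈)

-- Certifying rearrangements of lists by evaluation.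

module _ {A : Set} (_≟_ : DecidableEquality A) where

  -- Only a positive answer carries a proof, which suffices for certifying given lists.
  extract? : ∀ x (ys : List A) → Maybe (∃ λ zs → x ∷ zs ↭ ys)
  extract? x []       = nothing
  extract? x (y ∷ ys) with x ≟ y
  ... | yes refl = just (ys , ↭-refl)
  ... | no  _    = extract? x ys >>= λ (zs , p) →
    just (y ∷ zs , ↭-trans (↭-sym (shift x (y ∷ []) zs)) (prep y p))

  permute? : (xs ys : List A) → Maybe (xs ↭ ys)
  permute? []       []       = just ↭-refl
  permute? []       (_ ∷ _)  = nothing
  permute? (x ∷ xs) ys       =
    extract? x ys >>= λ (zs , p) → permute? xs zs >>= λ q → just (↭-trans (prep x q) p)

-- The default 0 makes the lookup total; all positions passed to it below are in range.
pick : List ℤ → ℕ → ℤ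
pick []       _       = 0ℤ
pick (x ∷ _)  zero    = x
pick (_ ∷ xs) (suc i) = pick xs i

-- Permutes a symbolic list by computing with the positions of its entries in ρ.

reorder : ∀ ρ is js {_ : T (is-just (permute? ℕ._≟_ is js))} → map (pick ρ) is ↭ map (pick ρ) js
reorder ρ is js {p} = map⁺ (pick ρ) (to-witness-T (permute? ℕ._≟_ is js) p)

-- Networks with one defect in each edge family.

Balanced : Vertex ℤ → Set
Balanced v = out₁ v + out₂ v ≡ at v + at v

-- The first edges out of vs enter every vertex once, except that h₁ is entered instead of s₁;
-- likewise for the second edges.

record Network (vs : List (Vertex ℤ)) (h₁ h₂ s₁ s₂ : ℤ) : Set where
  field
    balanced : All Balanced vs
    unique   : Unique (map at vs)
    in₁      : s₁ ∷ map out₁ vs ↭ h₁ ∷ map at vs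
    in₂      : s₂ ∷ map out₂ vs ↭ h₂ ∷ map at vs

mapVertex : ∀ {A B : Set} → (A → B) → Vertex A → Vertex B
mapVertex f (vertex a b c) = vertex (f a) (f b) (f c)

map-proj : ∀ {A B : Set} (f : A → B) (π : ∀ {C} → Vertex C → C) → (∀ v → π (mapVertex f v) ≡ f (π v)) →
           ∀ vs → map π (map (mapVertex f) vs) ≡ map f (map π vs)
map-proj f π eq []       = refl
map-proj f π eq (v ∷ vs) = cong₂ _∷_ (eq v) (map-proj f π eq vs)

affine : ℤ → ℤ → ℤ → ℤ
affine k c x = k * x + c

affine-injective : ∀ k c → k ≢ 0ℤ → ∀ {x y} → affine k c x ≡ affine k c y → x ≡ y
affine-injective k c k≢0 {x} {y} eq =
  ℤ.*-cancelˡ-≡ k x y {{≢-nonZero k≢0}} (∙-cancelʳ ℤ.+-0-abelianGroup c (k * x) (k * y) eq)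

-- `exchange` says that the new vertices `ws` turn the defect (h, s) into (h′, s′). Adding the two
-- hypotheses as multisets gives the claim with `h` and `s` on both sides; the chain trades `s` away
-- through `p`, so that only `h` is left to cancel.
append-in : ∀ (π : Vertex ℤ → ℤ) ws {vs h s h′ s′} → h ∷ s′ ∷ map π ws ↭ s ∷ h′ ∷ map at ws →
            s ∷ map π vs ↭ h ∷ map at vs → s′ ∷ map π (ws ++ vs) ↭ h′ ∷ map at (ws ++ vs)
append-in π ws {vs} {h} {s} {h′} {s′} exchange p = drop-∷ (begin
  h ∷ s′ ∷ map π (ws ++ vs)          ≡⟨ cong (λ xs → h ∷ s′ ∷ xs) (map-++ π ws vs) ⟩
  (h ∷ s′ ∷ map π ws) ++ map π vs    ↭⟨ ++⁺ʳ (map π vs) exchange ⟩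
  s ∷ (h′ ∷ map at ws) ++ map π vs   ↭⟨ shift s (h′ ∷ map at ws) (map π vs) ⟨
  (h′ ∷ map at ws) ++ s ∷ map π vs   ↭⟨ ++⁺ˡ (h′ ∷ map at ws) p ⟩
  (h′ ∷ map at ws) ++ h ∷ map at vs  ↭⟨ shift h (h′ ∷ map at ws) (map at vs) ⟩
  h ∷ h′ ∷ map at ws ++ map at vs    ≡⟨ cong (λ xs → h ∷ h′ ∷ xs) (map-++ at ws vs) ⟨
  h ∷ h′ ∷ map at (ws ++ vs)         ∎)
  where open PermutationReasoning

module _ {vs : List (Vertex ℤ)} {h₁ h₂ s₁ s₂ : ℤ} (N : Network vs h₁ h₂ s₁ s₂) where

  open Network N

  -- Affine maps preserve midpoints, and those with k ≠ 0 are injective and so keep the vertices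
  -- distinct.
  affineNetwork : ∀ k c → k ≢ 0ℤ → let f = affine k c in
                  Network (map (mapVertex f) vs) (f h₁) (f h₂) (f s₁) (f s₂)
  affineNetwork k c k≢0 = record
    { balanced = All.map⁺ (All.map balance balanced)
    ; unique   = subst Unique (sym (map-proj f at (λ _ → refl) vs)) (Unique.map⁺ (affine-injective k c k≢0) unique)
    ; in₁      = mapIn out₁ (map-proj f out₁ (λ _ → refl) vs) in₁
    ; in₂      = mapIn out₂ (map-proj f out₂ (λ _ → refl) vs) in₂
    }
    where
    f : ℤ → ℤ
    f = affine k c

    balance : ∀ {v} → Balanced v → Balanced (mapVertex f v)
    balance {v} eq = trans (eq′ (out₁ v) (out₂ v) k c)
      (trans (cong (λ x → k * x + (c + c)) eq) (sym (eq′ (at v) (at v) k c)))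
      where
      eq′ : ∀ x y k c → (k * x + c) + (k * y + c) ≡ k * (x + y) + (c + c)
      eq′ = solve-∀

    mapIn : ∀ (π : Vertex ℤ → ℤ) {h s} →
            map π (map (mapVertex f) vs) ≡ map f (map π vs) → s ∷ map π vs ↭ h ∷ map at vs →
            f s ∷ map π (map (mapVertex f) vs) ↭ f h ∷ map at (map (mapVertex f) vs)
    mapIn π {h} {s} eq p = subst₂ _↭_ (cong (f s ∷_) (sym eq))
      (cong (f h ∷_) (sym (map-proj f at (λ _ → refl) vs))) (map⁺ f p)

  extend : ∀ ws {h₁′ h₂′ s₁′ s₂′} → All Balanced ws → Unique (map at ws ++ map at vs) →
           h₁ ∷ s₁′ ∷ map out₁ ws ↭ s₁ ∷ h₁′ ∷ map at ws →
           h₂ ∷ s₂′ ∷ map out₂ ws ↭ s₂ ∷ h₂′ ∷ map at ws →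
           Network (ws ++ vs) h₁′ h₂′ s₁′ s₂′
  extend ws balanced′ unique′ exchange₁ exchange₂ = record
    { balanced = All.++⁺ balanced′ balanced
    ; unique   = subst Unique (sym (map-++ at ws vs)) unique′
    ; in₁      = append-in out₁ ws exchange₁ in₁
    ; in₂      = append-in out₂ ws exchange₂ in₂
    }

-- Stages and the rules that enlarge them.

-- Keeping 0 and ±n free lets these points become vertices later, after rescaling or in the final
-- closing step.
Inside : ℕ → ℤ → Set
Inside n x = x ≢ 0ℤ × ∣ x ∣ ℕ.< n

IsUnit : ℤ → Set
IsUnit s = s ≡ 1ℤ ⊎ s ≡ -1ℤ

-- A stage of the construction; s says which of ±1 lacks its incoming first edge.

record Config (n : ℕ) : Set where
  field
    vertices : List (Vertex ℤ)
    s        : ℤ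
    s-unit   : IsUnit s
    network  : Network vertices (+ n) (- (+ n)) s (- s)
    inside   : All (λ v → Inside n (at v)) vertices
    size     : length vertices ℕ.≤ 5 ℕ.* ⌊log₂ n ⌋

∣unit∣≡1 : ∀ {s} → IsUnit s → ∣ s ∣ ≡ 1
∣unit∣≡1 (inj₁ refl) = refl
∣unit∣≡1 (inj₂ refl) = refl

neg-unit : ∀ {s} → IsUnit s → IsUnit (- s)
neg-unit (inj₁ refl) = inj₂ refl
neg-unit (inj₂ refl) = inj₁ refl

∣i∣<∣j∣⇒j≢i : ∀ {i j} → ∣ i ∣ ℕ.< ∣ j ∣ → j ≢ i
∣i∣<∣j∣⇒j≢i lt refl = ℕ.<-irrefl refl lt

∣affine∣≤ : ∀ k c x → ∣ affine k c x ∣ ℕ.≤ ∣ k ∣ ℕ.* ∣ x ∣ ℕ.+ ∣ c ∣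
∣affine∣≤ k c x = ℕ.≤-trans (ℤ.∣i+j∣≤∣i∣+∣j∣ (k * x) c)
  (ℕ.≤-reflexive (cong (ℕ._+ ∣ c ∣) (ℤ.∣i*j∣≡∣i∣*∣j∣ k x)))

∣k∣∣m∣≤∣affine∣+∣c∣ : ∀ k c m → ∣ k ∣ ℕ.* ∣ m ∣ ℕ.≤ ∣ affine k c m ∣ ℕ.+ ∣ c ∣
∣k∣∣m∣≤∣affine∣+∣c∣ k c m = begin
  ∣ k ∣ ℕ.* ∣ m ∣          ≡⟨ ℤ.∣i*j∣≡∣i∣*∣j∣ k m ⟨
  ∣ k * m ∣                ≡⟨ cong ∣_∣ (eq k c m) ⟩
  ∣ affine k c m - c ∣     ≤⟨ ℤ.∣i-j∣≤∣i∣+∣j∣ (affine k c m) c ⟩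
  ∣ affine k c m ∣ ℕ.+ ∣ c ∣ ∎
  where
  open ℕ.≤-Reasoning
  eq : ∀ k c m → k * m ≡ (k * m + c) - c
  eq = solve-∀

-- Parity. It keeps the images of ±2x ± 1 away from 0 and from even numbers.
2i≢unit : ∀ k → ∣ k ∣ ≡ 2 → ∀ i {c} → ∣ c ∣ ≡ 1 → k * i ≢ c
2i≢unit k ∣k∣≡2 i {c} ∣c∣≡1 eq = contradiction
  (trans (sym (trans (ℤ.∣i*j∣≡∣i∣*∣j∣ k i) (cong (ℕ._* ∣ i ∣) ∣k∣≡2))) (trans (cong ∣_∣ eq) ∣c∣≡1))
  (2i≢1 ∣ i ∣)
  where
  2i≢1 : ∀ i → 2 ℕ.* i ≢ 1
  2i≢1 (suc i) eq with () ← trans (sym (ℕ.+-suc i (i ℕ.+ 0))) (ℕ.suc-injective eq)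

dropThird : ∀ {A : Set} {x y z : A} {xs} → Unique (x ∷ y ∷ z ∷ xs) → Unique (x ∷ y ∷ xs)
dropThird ((x≢y ∷ _ ∷ x∉) ∷ (_ ∷ y∉) ∷ _ ∷ !xs) = (x≢y ∷ x∉) ∷ y∉ ∷ !xs

module Grow {n′ : ℕ} (C : Config n′) (3≤n′ : 3 ℕ.≤ n′) where

  open Config C public

  m : ℤ
  m = + n′

  1≤n′ : 1 ℕ.≤ n′
  1≤n′ = ℕ.≤-trans (s≤s z≤n) 3≤n′

  ∣-m∣≡n′ : ∣ - m ∣ ≡ n′
  ∣-m∣≡n′ = ℤ.∣-i∣≡∣i∣ m

  ∣x∣≡n′⇒x≢0 : ∀ {x} → ∣ x ∣ ≡ n′ → x ≢ 0ℤ
  ∣x∣≡n′⇒x≢0 ∣x∣≡n′ refl = ℕ.<⇒≢ 1≤n′ ∣x∣≡n′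

  -- The free points of the stage precede its vertices in one list, so injectivity of the rescaling
  -- map yields distinctness of all their images at once.
  Unique-heads : Unique (m ∷ - m ∷ 0ℤ ∷ map at vertices)
  Unique-heads =
    (pos≢neg 1≤n′ ∷ ∣x∣≡n′⇒x≢0 refl ∷ fresh m ℕ.≤-refl) ∷
    (∣x∣≡n′⇒x≢0 ∣-m∣≡n′ ∷ fresh (- m) (ℕ.≤-reflexive (sym ∣-m∣≡n′))) ∷
    All.map⁺ (All.map (λ (≢0 , _) eq → ≢0 (sym eq)) inside) ∷ Network.unique network
    where
    pos≢neg : ∀ {n} → 1 ℕ.≤ n → + n ≢ - (+ n)
    pos≢neg (s≤s _) ()
    fresh : ∀ x → n′ ℕ.≤ ∣ x ∣ → All (x ≢_) (map at vertices)
    fresh x n′≤ = All.map⁺ (All.map (λ (_ , lt) → ∣i∣<∣j∣⇒j≢i (ℕ.<-≤-trans lt n′≤)) inside)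

  ∣heads∣≤n′ : All (λ x → ∣ x ∣ ℕ.≤ n′) (m ∷ - m ∷ 0ℤ ∷ map at vertices)
  ∣heads∣≤n′ = ℕ.≤-refl ∷ ℕ.≤-reflexive ∣-m∣≡n′ ∷ z≤n ∷
    All.map⁺ (All.map (λ (_ , lt) → ℕ.<⇒≤ lt) inside)

  -- The common frame of all rules: rescale by `f`, then add `ws`. At most five vertices are added
  -- while n at least doubles, so the bound 5 log₂ n persists. The names `a` and `b` allow `f s` and
  -- `f (- s)` to appear in simplified form in the exchanges.
  grow : ∀ {n} k c → k ≢ 0ℤ → let f = affine k c in
         ∀ ws s′ {a b} → IsUnit s′ → f s ≡ a → f (- s) ≡ b → length ws ℕ.≤ 5 → 2 ℕ.* n′ ℕ.≤ n →
         All Balanced ws → Unique (map at ws ++ map f (map at vertices)) →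
         f m ∷ s′ ∷ map out₁ ws ↭ a ∷ + n ∷ map at ws →
         f (- m) ∷ - s′ ∷ map out₂ ws ↭ b ∷ - (+ n) ∷ map at ws →
         All (λ v → Inside n (at v)) ws → (∀ x → Inside n′ x → Inside n (f x)) →
         Config n
  grow {n} k c k≢0 ws s′ s′-unit refl refl ws≤5 2n′≤n bal uniq exchange₁ exchange₂ inside-ws inside-f = record
    { vertices = ws ++ map (mapVertex f) vertices
    ; s        = s′
    ; s-unit   = s′-unit
    ; network  = extend (affineNetwork network k c k≢0) ws bal
        (subst (λ xs → Unique (map at ws ++ xs)) (sym (map-proj f at (λ _ → refl) vertices)) uniq)
        exchange₁ exchange₂
    ; inside   = All.++⁺ inside-ws (All.map⁺ (All.map (inside-f _) inside))
    ; size     = begin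
        length (ws ++ map (mapVertex f) vertices)
          ≡⟨ trans (length-++ ws) (cong (length ws ℕ.+_) (length-map (mapVertex f) vertices)) ⟩
        length ws ℕ.+ length vertices  ≤⟨ ℕ.+-mono-≤ ws≤5 size ⟩
        5 ℕ.+ 5 ℕ.* ⌊log₂ n′ ⌋         ≡⟨ ℕ.*-suc 5 ⌊log₂ n′ ⌋ ⟨
        5 ℕ.* suc ⌊log₂ n′ ⌋           ≡⟨ cong (5 ℕ.*_) (⌊log₂[2*b]⌋≡1+⌊log₂b⌋ n′) ⟨
        5 ℕ.* ⌊log₂ 2 ℕ.* n′ ⌋         ≤⟨ ℕ.*-monoʳ-≤ 5 (⌊log₂⌋-mono-≤ 2n′≤n) ⟩
        5 ℕ.* ⌊log₂ n ⌋                ∎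
    }
    where
    open ℕ.≤-Reasoning
    f : ℤ → ℤ
    f = affine k c
    instance
      n′≢0 : ℕ.NonZero n′
      n′≢0 = ℕ.>-nonZero 1≤n′

  ∣s∣≡1 : ∣ s ∣ ≡ 1
  ∣s∣≡1 = ∣unit∣≡1 s-unit

  -- The reflection x ↦ -x makes the first edges lead to -m and the second to m. Then m can send its
  -- first edge to 3m and its second to -m, and -m can send its first to m and its second to -3m.
  -- The unit lacking a first edge changes sign.
  triple : Config (3 ℕ.* n′)
  triple = grow -1ℤ 0ℤ (λ ())
    ( vertex v u (- (+ n))
    ∷ vertex u (+ n) v ∷ [])
    (- s) (neg-unit s-unit) (eq₁ s) (eq₂ s) (s≤s (s≤s z≤n))
    (ℕ.*-monoˡ-≤ n′ {2} {3} (s≤s (s≤s z≤n)))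
    (trans (cong (λ x → u - x) n≡3m) (eq₃ m) ∷ trans (cong (_+ v) n≡3m) (eq₄ m) ∷ [])
    (Unique.map⁺ (affine-injective -1ℤ 0ℤ (λ ())) (dropThird Unique-heads))
    (reorder (v ∷ u ∷ - s ∷ + n ∷ []) (0 ∷ 2 ∷ 1 ∷ 3 ∷ []) (2 ∷ 3 ∷ 0 ∷ 1 ∷ []))
    (reorder (v ∷ u ∷ - - s ∷ - (+ n) ∷ []) (1 ∷ 2 ∷ 3 ∷ 0 ∷ []) (2 ∷ 3 ∷ 0 ∷ 1 ∷ []))
    (inside-f m (∣x∣≡n′⇒x≢0 refl) ℕ.≤-refl ∷ inside-f (- m) (∣x∣≡n′⇒x≢0 ∣-m∣≡n′) (ℕ.≤-reflexive ∣-m∣≡n′) ∷ [])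
    (λ x (x≢0 , x<) → inside-f x x≢0 (ℕ.<⇒≤ x<))
    where
    n : ℕ
    n = 3 ℕ.* n′
    f : ℤ → ℤ
    f = affine -1ℤ 0ℤ
    v u : ℤ
    v = f m
    u = f (- m)
    n≡3m : + n ≡ + 3 * m
    n≡3m = ℤ.pos-* 3 n′
    eq₁ : ∀ s → -1ℤ * s + 0ℤ ≡ - s
    eq₁ = solve-∀
    eq₂ : ∀ s → -1ℤ * - s + 0ℤ ≡ - - s
    eq₂ = solve-∀
    eq₃ : ∀ m → (-1ℤ * - m + 0ℤ) - + 3 * m ≡ (-1ℤ * m + 0ℤ) + (-1ℤ * m + 0ℤ)
    eq₃ = solve-∀
    eq₄ : ∀ m → + 3 * m + (-1ℤ * m + 0ℤ) ≡ (-1ℤ * - m + 0ℤ) + (-1ℤ * - m + 0ℤ)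
    eq₄ = solve-∀
    ∣fx∣≡∣x∣ : ∀ x → ∣ f x ∣ ≡ ∣ x ∣
    ∣fx∣≡∣x∣ x = trans (cong ∣_∣ (trans (ℤ.+-identityʳ (-1ℤ * x)) (ℤ.-1*i≡-i x))) (ℤ.∣-i∣≡∣i∣ x)
    inside-f : ∀ x → x ≢ 0ℤ → ∣ x ∣ ℕ.≤ n′ → Inside n (f x)
    inside-f x x≢0 x≤ =
      (λ fx≡0 → x≢0 (ℤ.∣i∣≡0⇒i≡0 (trans (sym (∣fx∣≡∣x∣ x)) (cong ∣_∣ fx≡0)))) ,
      subst (ℕ._< n) (sym (∣fx∣≡∣x∣ x)) (ℕ.≤-<-trans x≤ (ℕ.m<m+n n′ (ℕ.≤-trans 1≤n′ (ℕ.m≤m+n n′ (n′ ℕ.+ 0)))))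

  -- The image is odd, hence nonzero, and has absolute value at most 2b + 1.
  inside-affine : ∀ {n b} k c → ∣ k ∣ ≡ 2 → ∣ c ∣ ≡ 1 → 2 ℕ.* b ℕ.+ 1 ℕ.< n →
                  ∀ x → ∣ x ∣ ℕ.≤ b → Inside n (affine k c x)
  inside-affine {n} {b} k c ∣k∣≡2 ∣c∣≡1 room x x≤b =
    (λ eq → 2i≢unit k ∣k∣≡2 x (trans (ℤ.∣-i∣≡∣i∣ c) ∣c∣≡1) (trans (eq′ (k * x) c) (trans (cong (_- c) eq) (ℤ.+-identityˡ (- c))))) ,
    (begin-strict
      ∣ affine k c x ∣             ≤⟨ ∣affine∣≤ k c x ⟩
      ∣ k ∣ ℕ.* ∣ x ∣ ℕ.+ ∣ c ∣    ≡⟨ cong₂ (λ i j → i ℕ.* ∣ x ∣ ℕ.+ j) ∣k∣≡2 ∣c∣≡1 ⟩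
      2 ℕ.* ∣ x ∣ ℕ.+ 1            ≤⟨ ℕ.+-monoˡ-≤ 1 (ℕ.*-monoʳ-≤ 2 x≤b) ⟩
      2 ℕ.* b ℕ.+ 1                <⟨ room ⟩
      n                            ∎)
    where
    open ℕ.≤-Reasoning
    eq′ : ∀ x c → x ≡ (x + c) - c
    eq′ = solve-∀

  quadruple-room : ∀ {n} → 4 ℕ.* n′ ℕ.≤ n ℕ.+ 1 → 2 ℕ.* n′ ℕ.+ 1 ℕ.< n
  quadruple-room {n} 4n′≤n+1 = ℕ.+-cancelʳ-≤ 1 (suc (2 ℕ.* n′ ℕ.+ 1)) n (begin
    suc (2 ℕ.* n′ ℕ.+ 1) ℕ.+ 1  ≡⟨ eq n′ ⟩
    2 ℕ.* n′ ℕ.+ 3              ≤⟨ ℕ.+-monoʳ-≤ (2 ℕ.* n′) (ℕ.≤-trans 3≤n′ (ℕ.m≤m+n n′ (n′ ℕ.+ 0))) ⟩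
    2 ℕ.* n′ ℕ.+ 2 ℕ.* n′       ≡⟨ ℕ.*-distribʳ-+ n′ 2 2 ⟨
    4 ℕ.* n′                    ≤⟨ 4n′≤n+1 ⟩
    n ℕ.+ 1                     ∎)
    where
    open ℕ.≤-Reasoning
    eq : ∀ n′ → suc (2 ℕ.* n′ ℕ.+ 1) ℕ.+ 1 ≡ 2 ℕ.* n′ ℕ.+ 3
    eq = ℕ-Solver.solve-∀

  -- The new vertex f(2m - c) comes from an argument as large as 2n′ + 1, hence the inner bound. The
  -- estimate amounts to 4n′ + 6 ≤ 6n′, which is exactly n′ ≥ 3.
  sextuple-room : ∀ {n} → 6 ℕ.* n′ ℕ.≤ n ℕ.+ 2 → 2 ℕ.* (2 ℕ.* n′ ℕ.+ 1) ℕ.+ 1 ℕ.< n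
  sextuple-room {n} 6n′≤n+2 = ℕ.+-cancelʳ-≤ 2 _ n (begin
    suc (2 ℕ.* (2 ℕ.* n′ ℕ.+ 1) ℕ.+ 1) ℕ.+ 2  ≡⟨ eq n′ ⟩
    4 ℕ.* n′ ℕ.+ 6                 ≤⟨ ℕ.+-monoʳ-≤ (4 ℕ.* n′) (ℕ.*-monoʳ-≤ 2 3≤n′) ⟩
    4 ℕ.* n′ ℕ.+ 2 ℕ.* n′          ≡⟨ ℕ.*-distribʳ-+ n′ 4 2 ⟨
    6 ℕ.* n′                       ≤⟨ 6n′≤n+2 ⟩
    n ℕ.+ 2                        ∎)
    where
    open ℕ.≤-Reasoning
    eq : ∀ n′ → suc (2 ℕ.* (2 ℕ.* n′ ℕ.+ 1) ℕ.+ 1) ℕ.+ 2 ≡ 4 ℕ.* n′ ℕ.+ 6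
    eq = ℕ-Solver.solve-∀

  -- After x ↦ 2x + s, the point 3s lacks a first edge and -s a second one. The free points m, -m, 0
  -- become the vertices `v`, `u`, s. Here `u` supplies the edge to 3s, while the new vertex s is
  -- left without a first edge and -s without a second, so the same `s` serves again.
  quadruple+s : ∀ {n} → + n ≡ + 4 * m + s → Config n
  quadruple+s {n} n≡4m+s = grow (+ 2) s (λ ())
    ( vertex v (+ n) s
    ∷ vertex u (f s) (- (+ n))
    ∷ vertex s u v ∷ [])
    s s-unit refl (eq₀ s) (s≤s (s≤s (s≤s z≤n))) (ℕ.<⇒≤ (ℕ.≤-<-trans (ℕ.m≤m+n _ 1) room))
    ( trans (cong (_+ s) n≡4m+s) (eq₁ m s)
    ∷ trans (cong (λ x → f s - x) n≡4m+s) (eq₂ m s)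
    ∷ eq₃ m s ∷ [])
    (subst Unique (cong (λ x → v ∷ u ∷ x ∷ map f (map at vertices)) (f0≡s s))
      (Unique.map⁺ (affine-injective (+ 2) s (λ ())) Unique-heads))
    (reorder (v ∷ u ∷ s ∷ + n ∷ f s ∷ []) (0 ∷ 2 ∷ 3 ∷ 4 ∷ 1 ∷ []) (4 ∷ 3 ∷ 0 ∷ 1 ∷ 2 ∷ []))
    (reorder (v ∷ u ∷ s ∷ - (+ n) ∷ - s ∷ []) (1 ∷ 4 ∷ 2 ∷ 3 ∷ 0 ∷ []) (4 ∷ 3 ∷ 0 ∷ 1 ∷ 2 ∷ []))
    ( inside-f m ℕ.≤-refl ∷ inside-f (- m) (ℕ.≤-reflexive ∣-m∣≡n′)
    ∷ subst (Inside n) (f0≡s s) (inside-f 0ℤ z≤n) ∷ [])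
    (λ x (_ , x<) → inside-f x (ℕ.<⇒≤ x<))
    where
    f : ℤ → ℤ
    f = affine (+ 2) s
    v u : ℤ
    v = f m
    u = f (- m)
    room : 2 ℕ.* n′ ℕ.+ 1 ℕ.< n
    room = quadruple-room (subst₂ (λ x y → 4 ℕ.* n′ ℕ.≤ ∣ x ∣ ℕ.+ y) (sym n≡4m+s) ∣s∣≡1
      (∣k∣∣m∣≤∣affine∣+∣c∣ (+ 4) s m))
    inside-f : ∀ x → ∣ x ∣ ℕ.≤ n′ → Inside n (f x)
    inside-f = inside-affine (+ 2) s refl ∣s∣≡1 room
    eq₀ : ∀ s → + 2 * - s + s ≡ - s
    eq₀ = solve-∀
    eq₁ : ∀ m s → (+ 4 * m + s) + s ≡ (+ 2 * m + s) + (+ 2 * m + s)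
    eq₁ = solve-∀
    eq₂ : ∀ m s → (+ 2 * s + s) - (+ 4 * m + s) ≡ (+ 2 * - m + s) + (+ 2 * - m + s)
    eq₂ = solve-∀
    eq₃ : ∀ m s → (+ 2 * - m + s) + (+ 2 * m + s) ≡ s + s
    eq₃ = solve-∀
    f0≡s : ∀ s → + 2 * 0ℤ + s ≡ s
    f0≡s = solve-∀

  -- The map is the negative of the one in `quadruple+s`, which exchanges the two edge families at
  -- the ends: `v` now leads to -n and `u` to n. The new vertex -s lacks the first edge.
  quadruple-s : ∀ {n} → + n ≡ + 4 * m - s → Config n
  quadruple-s {n} n≡4m-s = grow (- + 2) (- s) (λ ())
    ( vertex v (f s) (- (+ n))
    ∷ vertex u (+ n) (- s)
    ∷ vertex (- s) u v ∷ [])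
    (- s) (neg-unit s-unit) refl (eq₀ s) (s≤s (s≤s (s≤s z≤n)))
    (ℕ.<⇒≤ (ℕ.≤-<-trans (ℕ.m≤m+n _ 1) room))
    ( trans (cong (λ x → f s - x) n≡4m-s) (eq₁ m s)
    ∷ trans (cong (_- s) n≡4m-s) (eq₂ m s)
    ∷ eq₃ m s ∷ [])
    (subst Unique (cong (λ x → v ∷ u ∷ x ∷ map f (map at vertices)) (f0≡-s s))
      (Unique.map⁺ (affine-injective (- + 2) (- s) (λ ())) Unique-heads))
    (reorder (v ∷ u ∷ - s ∷ + n ∷ f s ∷ []) (0 ∷ 2 ∷ 4 ∷ 3 ∷ 1 ∷ []) (4 ∷ 3 ∷ 0 ∷ 1 ∷ 2 ∷ []))
    (reorder (v ∷ u ∷ - s ∷ - (+ n) ∷ - - s ∷ []) (1 ∷ 4 ∷ 3 ∷ 2 ∷ 0 ∷ []) (4 ∷ 3 ∷ 0 ∷ 1 ∷ 2 ∷ []))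
    ( inside-f m ℕ.≤-refl ∷ inside-f (- m) (ℕ.≤-reflexive ∣-m∣≡n′)
    ∷ subst (Inside n) (f0≡-s s) (inside-f 0ℤ z≤n) ∷ [])
    (λ x (_ , x<) → inside-f x (ℕ.<⇒≤ x<))
    where
    f : ℤ → ℤ
    f = affine (- + 2) (- s)
    v u : ℤ
    v = f m
    u = f (- m)
    ∣-s∣≡1 : ∣ - s ∣ ≡ 1
    ∣-s∣≡1 = ∣unit∣≡1 (neg-unit s-unit)
    room : 2 ℕ.* n′ ℕ.+ 1 ℕ.< n
    room = quadruple-room (subst₂ (λ x y → 4 ℕ.* n′ ℕ.≤ ∣ x ∣ ℕ.+ y) (sym n≡4m-s) ∣-s∣≡1
      (∣k∣∣m∣≤∣affine∣+∣c∣ (+ 4) (- s) m))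
    inside-f : ∀ x → ∣ x ∣ ℕ.≤ n′ → Inside n (f x)
    inside-f = inside-affine (- + 2) (- s) refl ∣-s∣≡1 room
    eq₀ : ∀ s → - + 2 * - s + - s ≡ - - s
    eq₀ = solve-∀
    eq₁ : ∀ m s → (- + 2 * s + - s) - (+ 4 * m - s) ≡ (- + 2 * m + - s) + (- + 2 * m + - s)
    eq₁ = solve-∀
    eq₂ : ∀ m s → (+ 4 * m - s) - s ≡ (- + 2 * - m + - s) + (- + 2 * - m + - s)
    eq₂ = solve-∀
    eq₃ : ∀ m s → (- + 2 * - m + - s) + (- + 2 * m + - s) ≡ - s + - s
    eq₃ = solve-∀
    f0≡-s : ∀ s → - + 2 * 0ℤ + - s ≡ - s
    f0≡-s = solve-∀

  -- Under f, τ corresponds to m − c/2, the midpoint of 0 and 2m − c.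

  module Sextuple {n : ℕ} (c : ℤ) (∣c∣≡1 : ∣ c ∣ ≡ 1) (n≡6m-2c : + n ≡ + 6 * m - + 2 * c) where

    f : ℤ → ℤ
    f = affine (+ 2) c

    v u w τ : ℤ
    v = f m
    u = f (- m)
    w = f (+ 2 * m - c)
    τ = + 2 * m

    room : 2 ℕ.* (2 ℕ.* n′ ℕ.+ 1) ℕ.+ 1 ℕ.< n
    room = sextuple-room (subst₂ (λ x y → 6 ℕ.* n′ ℕ.≤ ∣ x ∣ ℕ.+ y) (sym n≡6m-2c) ∣-2c∣≡2
      (∣k∣∣m∣≤∣affine∣+∣c∣ (+ 6) (- (+ 2 * c)) m))
      where
      ∣-2c∣≡2 : ∣ - (+ 2 * c) ∣ ≡ 2
      ∣-2c∣≡2 = trans (ℤ.∣-i∣≡∣i∣ (+ 2 * c)) (trans (ℤ.∣i*j∣≡∣i∣*∣j∣ (+ 2) c) (cong (2 ℕ.*_) ∣c∣≡1))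

    n′≤2n′+1 : n′ ℕ.≤ 2 ℕ.* n′ ℕ.+ 1
    n′≤2n′+1 = ℕ.≤-trans (ℕ.m≤m+n n′ (n′ ℕ.+ 0)) (ℕ.m≤m+n _ 1)

    2n′≤n : 2 ℕ.* n′ ℕ.≤ n
    2n′≤n = ℕ.≤-trans (ℕ.m≤m+n (2 ℕ.* n′) 1)
      (ℕ.≤-trans (ℕ.≤-trans (ℕ.m≤n*m (2 ℕ.* n′ ℕ.+ 1) 2) (ℕ.m≤m+n _ 1)) (ℕ.<⇒≤ room))

    inside-f : ∀ x → ∣ x ∣ ℕ.≤ 2 ℕ.* n′ ℕ.+ 1 → Inside n (f x)
    inside-f = inside-affine (+ 2) c refl ∣c∣≡1 room

    -- Beyond all free points and vertices of the old stage, so `w` is new after rescaling.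
    far : n′ ℕ.< ∣ + 2 * m - c ∣
    far = ℕ.+-cancelʳ-≤ 1 _ _ (begin
      suc n′ ℕ.+ 1   ≡⟨ ℕ.+-suc n′ 1 ⟨
      n′ ℕ.+ 2       ≤⟨ ℕ.+-monoʳ-≤ n′ (ℕ.≤-trans (ℕ.n≤1+n 2) (ℕ.≤-trans 3≤n′ (ℕ.m≤m+n n′ 0))) ⟩
      2 ℕ.* n′       ≤⟨ ∣k∣∣m∣≤∣affine∣+∣c∣ (+ 2) (- c) m ⟩
      ∣ + 2 * m - c ∣ ℕ.+ ∣ - c ∣ ≡⟨ cong (∣ + 2 * m - c ∣ ℕ.+_) (trans (ℤ.∣-i∣≡∣i∣ c) ∣c∣≡1) ⟩
      ∣ + 2 * m - c ∣ ℕ.+ 1 ∎)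
      where open ℕ.≤-Reasoning

    -- `τ` is even and every other entry is odd; `w` is separated from the rest by size before
    -- rescaling.
    Unique-new : ∀ {t} → f 0ℤ ≡ t →
                 Unique (τ ∷ w ∷ v ∷ u ∷ t ∷ map f (map at vertices))
    Unique-new refl =
      All.map⁺ (All.universal (λ x eq → 2i≢unit (+ 2) refl (m - x) ∣c∣≡1
        (trans (eq₁ m x) (trans (cong (_- + 2 * x) eq) (eq₂ x c))))
        (+ 2 * m - c ∷ m ∷ - m ∷ 0ℤ ∷ map at vertices)) ∷
      Unique.map⁺ (affine-injective (+ 2) c (λ ()))
        (All.map (λ x≤ → ∣i∣<∣j∣⇒j≢i {j = + 2 * m - c} (ℕ.≤-<-trans x≤ far)) ∣heads∣≤n′ ∷ Unique-heads)
      where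
      eq₁ : ∀ m x → + 2 * (m - x) ≡ + 2 * m - + 2 * x
      eq₁ = solve-∀
      eq₂ : ∀ x c → (+ 2 * x + c) - + 2 * x ≡ c
      eq₂ = solve-∀

    inside-new : ∀ {t} → f 0ℤ ≡ t → All (Inside n) (τ ∷ w ∷ v ∷ u ∷ t ∷ [])
    inside-new refl =
      ( (λ eq → ∣x∣≡n′⇒x≢0 {m} refl (ℤ.*-cancelˡ-≡ (+ 2) m 0ℤ eq))
      , subst (ℕ._< n) (sym (ℤ.∣i*j∣≡∣i∣*∣j∣ (+ 2) m)) (ℕ.≤-<-trans (ℕ.≤-trans (ℕ.m≤m+n _ 1)
          (ℕ.≤-trans (ℕ.m≤n*m (2 ℕ.* n′ ℕ.+ 1) 2) (ℕ.m≤m+n _ 1))) room))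
      ∷ inside-f (+ 2 * m - c) (subst (λ y → ∣ + 2 * m - c ∣ ℕ.≤ 2 ℕ.* n′ ℕ.+ y)
          (trans (ℤ.∣-i∣≡∣i∣ c) ∣c∣≡1) (∣affine∣≤ (+ 2) (- c) m))
      ∷ inside-f m n′≤2n′+1
      ∷ inside-f (- m) (subst (ℕ._≤ 2 ℕ.* n′ ℕ.+ 1) (sym ∣-m∣≡n′) n′≤2n′+1)
      ∷ inside-f 0ℤ z≤n ∷ []

    inside-old : ∀ x → Inside n′ x → Inside n (f x)
    inside-old x (_ , x<) = inside-f x (ℕ.≤-trans (ℕ.<⇒≤ x<) n′≤2n′+1)

  -- `w` is the midpoint of n and `τ`, and `u` that of `τ` and -n, so the ends can lie near ±6m
  -- although `f` only doubles. The new vertex s = f 0 lacks a first edge, and -s = f(-s) still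
  -- lacks a second one.
  sextuple-2s : ∀ {n} → + n ≡ + 6 * m - + 2 * s → Config n
  sextuple-2s {n} n≡6m-2s = grow (+ 2) s (λ ())
    ( vertex τ w s
    ∷ vertex w (+ n) τ
    ∷ vertex v (f s) w
    ∷ vertex u τ (- (+ n))
    ∷ vertex s u v ∷ [])
    s s-unit refl (eq₀ s) ℕ.≤-refl 2n′≤n
    (eq₁ m s ∷ trans (cong (_+ τ) n≡6m-2s) (eq₂ m s) ∷ eq₃ m s
      ∷ trans (cong (λ x → τ - x) n≡6m-2s) (eq₄ m s) ∷ eq₅ m s ∷ [])
    (Unique-new (f0≡s s))
    (reorder (τ ∷ w ∷ v ∷ u ∷ s ∷ f s ∷ + n ∷ []) (2 ∷ 4 ∷ 1 ∷ 6 ∷ 5 ∷ 0 ∷ 3 ∷ []) (5 ∷ 6 ∷ 0 ∷ 1 ∷ 2 ∷ 3 ∷ 4 ∷ []))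
    (reorder (τ ∷ w ∷ v ∷ u ∷ s ∷ - s ∷ - (+ n) ∷ []) (3 ∷ 5 ∷ 4 ∷ 0 ∷ 1 ∷ 6 ∷ 2 ∷ []) (5 ∷ 6 ∷ 0 ∷ 1 ∷ 2 ∷ 3 ∷ 4 ∷ []))
    (All.map⁻ (inside-new (f0≡s s))) inside-old
    where
    open Sextuple s ∣s∣≡1 n≡6m-2s
    f0≡s : ∀ s → + 2 * 0ℤ + s ≡ s
    f0≡s = solve-∀
    eq₀ : ∀ s → + 2 * - s + s ≡ - s
    eq₀ = solve-∀
    eq₁ : ∀ m s → (+ 2 * (+ 2 * m - s) + s) + s ≡ + 2 * m + + 2 * m
    eq₁ = solve-∀
    eq₂ : ∀ m s → (+ 6 * m - + 2 * s) + + 2 * m ≡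
          (+ 2 * (+ 2 * m - s) + s) + (+ 2 * (+ 2 * m - s) + s)
    eq₂ = solve-∀
    eq₃ : ∀ m s → (+ 2 * s + s) + (+ 2 * (+ 2 * m - s) + s) ≡ (+ 2 * m + s) + (+ 2 * m + s)
    eq₃ = solve-∀
    eq₄ : ∀ m s → + 2 * m - (+ 6 * m - + 2 * s) ≡ (+ 2 * - m + s) + (+ 2 * - m + s)
    eq₄ = solve-∀
    eq₅ : ∀ m s → (+ 2 * - m + s) + (+ 2 * m + s) ≡ s + s
    eq₅ = solve-∀

  -- With 2x - s instead, s = f s keeps lacking its first edge, and the new vertex -s = f 0 lacks a
  -- second one. The edges of `τ` and `v` are swapped between the families accordingly.
  sextuple+2s : ∀ {n} → + n ≡ + 6 * m + + 2 * s → Config n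
  sextuple+2s {n} n≡6m+2s = grow (+ 2) (- s) (λ ())
    ( vertex τ (- s) w
    ∷ vertex w (+ n) τ
    ∷ vertex v w (f (- s))
    ∷ vertex u τ (- (+ n))
    ∷ vertex (- s) u v ∷ [])
    s s-unit (eq₀ s) refl ℕ.≤-refl 2n′≤n
    (eq₁ m s ∷ trans (cong (_+ τ) n≡6m+2s) (eq₂ m s) ∷ eq₃ m s
      ∷ trans (cong (λ x → τ - x) n≡6m+2s) (eq₄ m s) ∷ eq₅ m s ∷ [])
    (Unique-new (f0≡-s s))
    (reorder (τ ∷ w ∷ v ∷ u ∷ - s ∷ s ∷ + n ∷ []) (2 ∷ 5 ∷ 4 ∷ 6 ∷ 1 ∷ 0 ∷ 3 ∷ []) (5 ∷ 6 ∷ 0 ∷ 1 ∷ 2 ∷ 3 ∷ 4 ∷ []))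
    (reorder (τ ∷ w ∷ v ∷ u ∷ - s ∷ f (- s) ∷ - (+ n) ∷ []) (3 ∷ 4 ∷ 1 ∷ 0 ∷ 5 ∷ 6 ∷ 2 ∷ []) (5 ∷ 6 ∷ 0 ∷ 1 ∷ 2 ∷ 3 ∷ 4 ∷ []))
    (All.map⁻ (inside-new (f0≡-s s))) inside-old
    where
    eq₆ : ∀ m s → + 6 * m + + 2 * s ≡ + 6 * m - + 2 * - s
    eq₆ = solve-∀
    open Sextuple (- s) (∣unit∣≡1 (neg-unit s-unit)) (trans n≡6m+2s (eq₆ m s))
    f0≡-s : ∀ s → + 2 * 0ℤ + - s ≡ - s
    f0≡-s = solve-∀
    eq₀ : ∀ s → + 2 * s + - s ≡ s
    eq₀ = solve-∀
    eq₁ : ∀ m s → - s + (+ 2 * (+ 2 * m - - s) + - s) ≡ + 2 * m + + 2 * m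
    eq₁ = solve-∀
    eq₂ : ∀ m s → (+ 6 * m + + 2 * s) + + 2 * m ≡
          (+ 2 * (+ 2 * m - - s) + - s) + (+ 2 * (+ 2 * m - - s) + - s)
    eq₂ = solve-∀
    eq₃ : ∀ m s → (+ 2 * (+ 2 * m - - s) + - s) + (+ 2 * - s + - s) ≡ (+ 2 * m + - s) + (+ 2 * m + - s)
    eq₃ = solve-∀
    eq₄ : ∀ m s → + 2 * m - (+ 6 * m + + 2 * s) ≡ (+ 2 * - m + - s) + (+ 2 * - m + - s)
    eq₄ = solve-∀
    eq₅ : ∀ m s → (+ 2 * - m + - s) + (+ 2 * m + - s) ≡ - s + - s
    eq₅ = solve-∀

-- Small stages, checked by evaluation.

balanced? : ∀ v → Dec (Balanced v)
balanced? v = out₁ v + out₂ v ℤ.≟ at v + at v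

inside? : ∀ n x → Dec (Inside n x)
inside? n x = ¬? (x ℤ.≟ 0ℤ) ×-dec (∣ x ∣ ℕ.<? n)

checked : ∀ n s vs → IsUnit s →
          {True (All.all? balanced? vs)} → {True (DecUnique.unique? ℤ._≟_ (map at vs))} →
          {T (is-just (permute? ℤ._≟_ (s ∷ map out₁ vs) (+ n ∷ map at vs)))} →
          {T (is-just (permute? ℤ._≟_ (- s ∷ map out₂ vs) (- (+ n) ∷ map at vs)))} →
          {True (All.all? (λ v → inside? n (at v)) vs)} →
          {True (length vs ℕ.≤? 5 ℕ.* ⌊log₂ n ⌋)} → Config n
checked n s vs s-unit {b} {u} {p₁} {p₂} {i} {l} = record
  { vertices = vs
  ; s        = s
  ; s-unit   = s-unit
  ; network  = record
    { balanced = toWitness b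
    ; unique   = toWitness u
    ; in₁      = to-witness-T (permute? ℤ._≟_ (s ∷ map out₁ vs) (+ n ∷ map at vs)) p₁
    ; in₂      = to-witness-T (permute? ℤ._≟_ (- s ∷ map out₂ vs) (- (+ n) ∷ map at vs)) p₂
    }
  ; inside   = toWitness i
  ; size     = toWitness l
  }

-- Successors are given by a displacement, so each tabulated vertex is their midpoint by
-- construction.
spread : ℤ → ℤ → Vertex ℤ
spread x d = vertex x (x + d) (x - d)

-- The tabulated sizes are those from 3 on that the rules would only reach from a stage below 3.
config₃ : Config 3
config₃ = checked 3 -1ℤ (spread (+ 1) (+ 2) ∷ spread (- + 1) (+ 2) ∷ []) (inj₂ refl)

config₄ : Config 4
config₄ = checked 4 1ℤ
  (spread (+ 1) (- + 2) ∷ spread (+ 3) (+ 1) ∷ spread (+ 2) (+ 1) ∷ spread (- + 1) (+ 3) ∷ []) (inj₁ refl)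

config₅ : Config 5
config₅ = checked 5 1ℤ
  (spread (+ 1) (- + 2) ∷ spread (+ 3) (+ 2) ∷ spread (- + 1) (+ 4) ∷ []) (inj₁ refl)

config₆ : Config 6
config₆ = checked 6 1ℤ
  (spread (+ 1) (- + 2) ∷ spread (+ 3) (- + 1) ∷ spread (+ 4) (+ 2) ∷ spread (+ 2) (+ 1)
    ∷ spread (- + 1) (+ 5) ∷ []) (inj₁ refl)

config₇ : Config 7
config₇ = checked 7 -1ℤ
  (spread (+ 1) (+ 2) ∷ spread (+ 3) (- + 2) ∷ spread (+ 5) (+ 2) ∷ spread (- + 1) (+ 6) ∷ []) (inj₂ refl)

config₈ : Config 8
config₈ = checked 8 1ℤ
  (spread (+ 1) (- + 2) ∷ spread (+ 3) (+ 5) ∷ spread (- + 2) (- + 3) ∷ spread (- + 5) (+ 3)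
    ∷ spread (- + 1) (+ 4) ∷ []) (inj₁ refl)

config₁₀ : Config 10
config₁₀ = checked 10 1ℤ
  (spread (+ 1) (- + 2) ∷ spread (+ 3) (+ 7) ∷ spread (- + 4) (+ 6) ∷ spread (+ 2) (+ 1)
    ∷ spread (- + 1) (- + 3) ∷ []) (inj₁ refl)

config₁₄ : Config 14
config₁₄ = checked 14 1ℤ
  (spread (+ 1) (- + 2) ∷ spread (+ 3) (+ 1) ∷ spread (+ 4) (+ 10) ∷ spread (- + 6) (+ 8)
    ∷ spread (+ 2) (+ 1) ∷ spread (- + 1) (- + 5) ∷ []) (inj₁ refl)

-- All stages from 3 on, by strong induction.

module _ {n n′ : ℕ} (C : Config n′) (3≤n′ : 3 ℕ.≤ n′) where

  open Grow C 3≤n′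

  -- The rules shift by ±s rather than ±1; for either value of the unit `s`, one of the two gives
  -- the required sign.
  quadruple+1 : n ≡ 4 ℕ.* n′ ℕ.+ 1 → Config n
  quadruple+1 n≡ = helper s-unit (trans (cong +_ n≡) (cong (_+ 1ℤ) (ℤ.pos-* 4 n′)))
    where
    helper : IsUnit s → + n ≡ + 4 * m + 1ℤ → Config n
    helper (inj₁ s≡1)  eq = quadruple+s (trans eq (cong (λ s → + 4 * m + s) (sym s≡1)))
    helper (inj₂ s≡-1) eq = quadruple-s (trans eq (cong (λ s → + 4 * m - s) (sym s≡-1)))

  quadruple-1 : n ℕ.+ 1 ≡ 4 ℕ.* n′ → Config n
  quadruple-1 n+1≡ = helper s-unit (trans (cancel (+ n)) (cong (_- 1ℤ) (trans (cong +_ n+1≡) (ℤ.pos-* 4 n′))))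
    where
    cancel : ∀ x → x ≡ (x + 1ℤ) - 1ℤ
    cancel = solve-∀
    helper : IsUnit s → + n ≡ + 4 * m - 1ℤ → Config n
    helper (inj₁ s≡1)  eq = quadruple-s (trans eq (cong (λ s → + 4 * m - s) (sym s≡1)))
    helper (inj₂ s≡-1) eq = quadruple+s (trans eq (cong (λ s → + 4 * m + s) (sym s≡-1)))

  sextuple+2 : n ≡ 6 ℕ.* n′ ℕ.+ 2 → Config n
  sextuple+2 n≡ = helper s-unit (trans (cong +_ n≡) (cong (_+ + 2) (ℤ.pos-* 6 n′)))
    where
    helper : IsUnit s → + n ≡ + 6 * m + + 2 → Config n
    helper (inj₁ s≡1)  eq = sextuple+2s (trans eq (cong (λ s → + 6 * m + + 2 * s) (sym s≡1)))
    helper (inj₂ s≡-1) eq = sextuple-2s (trans eq (cong (λ s → + 6 * m - + 2 * s) (sym s≡-1)))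

  sextuple-2 : n ℕ.+ 2 ≡ 6 ℕ.* n′ → Config n
  sextuple-2 n+2≡ = helper s-unit (trans (cancel (+ n)) (cong (_- + 2) (trans (cong +_ n+2≡) (ℤ.pos-* 6 n′))))
    where
    cancel : ∀ x → x ≡ (x + + 2) - + 2
    cancel = solve-∀
    helper : IsUnit s → + n ≡ + 6 * m - + 2 → Config n
    helper (inj₁ s≡1)  eq = sextuple-2s (trans eq (cong (λ s → + 6 * m - + 2 * s) (sym s≡1)))
    helper (inj₂ s≡-1) eq = sextuple+2s (trans eq (cong (λ s → + 6 * m + + 2 * s) (sym s≡-1)))

  tripled : n ≡ 3 ℕ.* n′ → Config n
  tripled n≡ = subst Config (sym n≡) triple

-- Odd n are 4m ± 1; even n are 6m ± 2 or triples of even numbers. In each case 2m ≤ n + 2, with the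
-- 2 coming from 6m - 2, and together with m ≥ 3 this gives m < n.
config : ∀ n → 3 ℕ.≤ n → Config n
config = <-rec _ λ n rec → step n λ m 3≤m 2m≤n+2 → rec (smaller 3≤m 2m≤n+2) 3≤m
  where
  smaller : ∀ {m n} → 3 ℕ.≤ m → 2 ℕ.* m ℕ.≤ n ℕ.+ 2 → m ℕ.< n
  smaller {m} {n} 3≤m 2m≤n+2 = ℕ.+-cancelʳ-≤ 2 (suc m) n (begin
    suc m ℕ.+ 2    ≡⟨ ℕ.+-suc m 2 ⟨
    m ℕ.+ 3        ≤⟨ ℕ.+-monoʳ-≤ m (ℕ.≤-trans 3≤m (ℕ.m≤m+n m 0)) ⟩
    2 ℕ.* m        ≤⟨ 2m≤n+2 ⟩
    n ℕ.+ 2        ∎)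
    where open ℕ.≤-Reasoning

  3≤2j : ∀ j → 3 ℕ.≤ 2 ℕ.* (2 ℕ.+ j)
  3≤2j j = ℕ.≤-trans (s≤s (s≤s (s≤s z≤n))) (ℕ.*-monoʳ-≤ 2 (ℕ.m≤m+n 2 j))

  3+ : ∀ {j} → 3 ℕ.≤ 3 ℕ.+ j
  3+ = s≤s (s≤s (s≤s z≤n))

  module _ {n} (rec : ∀ m → 3 ℕ.≤ m → 2 ℕ.* m ℕ.≤ n ℕ.+ 2 → Config m) (3≤n : 3 ℕ.≤ n) where

    room : ∀ k c m → 2 ℕ.≤ k → n ℕ.+ c ≡ k ℕ.* m → c ℕ.≤ 2 → 2 ℕ.* m ℕ.≤ n ℕ.+ 2
    room k c m 2≤k eq c≤2 =
      ℕ.≤-trans (ℕ.*-monoˡ-≤ m 2≤k) (ℕ.≤-trans (ℕ.≤-reflexive (sym eq)) (ℕ.+-monoʳ-≤ n c≤2))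

    room′ : ∀ k c m → 2 ℕ.≤ k → n ≡ k ℕ.* m ℕ.+ c → 2 ℕ.* m ℕ.≤ n ℕ.+ 2
    room′ k c m 2≤k eq = ℕ.≤-trans (ℕ.*-monoˡ-≤ m 2≤k)
      (ℕ.≤-trans (ℕ.m≤m+n (k ℕ.* m) c) (ℕ.≤-trans (ℕ.≤-reflexive (sym eq)) (ℕ.m≤m+n n 2)))

    case-6j : ∀ j → n ≡ j ℕ.* 3 ℕ.* 2 → Config n
    case-6j 0 refl = contradiction 3≤n λ ()
    case-6j 1 refl = config₆
    case-6j j@(suc (suc i)) n≡ =
      tripled (rec (2 ℕ.* j) (3≤2j i) (room′ 3 0 (2 ℕ.* j) (s≤s (s≤s z≤n)) (trans eq (sym (ℕ.+-identityʳ _)))))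
        (3≤2j i) eq
      where
      eq : n ≡ 3 ℕ.* (2 ℕ.* j)
      eq = trans n≡ (e j)
        where
        e : ∀ j → j ℕ.* 3 ℕ.* 2 ≡ 3 ℕ.* (2 ℕ.* j)
        e = ℕ-Solver.solve-∀

    case-6j+2 : ∀ j → n ≡ (1 ℕ.+ j ℕ.* 3) ℕ.* 2 → Config n
    case-6j+2 0 refl = contradiction 3≤n λ { (s≤s (s≤s ())) }
    case-6j+2 1 refl = config₈
    case-6j+2 2 refl = config₁₄
    case-6j+2 j@(suc (suc (suc _))) n≡ =
      sextuple+2 (rec j 3+ (room′ 6 2 j (s≤s (s≤s z≤n)) eq)) 3+ eq
      where
      eq : n ≡ 6 ℕ.* j ℕ.+ 2
      eq = trans n≡ (e j)
        where
        e : ∀ j → (1 ℕ.+ j ℕ.* 3) ℕ.* 2 ≡ 6 ℕ.* j ℕ.+ 2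
        e = ℕ-Solver.solve-∀

    case-6j+4 : ∀ j → n ≡ (2 ℕ.+ j ℕ.* 3) ℕ.* 2 → Config n
    case-6j+4 0 refl = config₄
    case-6j+4 1 refl = config₁₀
    case-6j+4 j@(suc (suc _)) n≡ =
      sextuple-2 (rec (suc j) 3+ (room 6 2 (suc j) (s≤s (s≤s z≤n)) eq ℕ.≤-refl)) 3+ eq
      where
      eq : n ℕ.+ 2 ≡ 6 ℕ.* suc j
      eq = trans (cong (ℕ._+ 2) n≡) (e j)
        where
        e : ∀ j → (2 ℕ.+ j ℕ.* 3) ℕ.* 2 ℕ.+ 2 ≡ 6 ℕ.* suc j
        e = ℕ-Solver.solve-∀

    case-4j+1 : ∀ j → n ≡ 1 ℕ.+ j ℕ.* 2 ℕ.* 2 → Config n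
    case-4j+1 0 refl = contradiction 3≤n λ { (s≤s ()) }
    case-4j+1 1 refl = config₅
    -- 9 = 4·2 + 1 would call for stage 2, so it is obtained as 3·3.
    case-4j+1 2 refl = tripled config₃ 3+ refl
    case-4j+1 j@(suc (suc (suc _))) n≡ =
      quadruple+1 (rec j 3+ (room′ 4 1 j (s≤s (s≤s z≤n)) eq)) 3+ eq
      where
      eq : n ≡ 4 ℕ.* j ℕ.+ 1
      eq = trans n≡ (e j)
        where
        e : ∀ j → 1 ℕ.+ j ℕ.* 2 ℕ.* 2 ≡ 4 ℕ.* j ℕ.+ 1
        e = ℕ-Solver.solve-∀

    case-4j+3 : ∀ j → n ≡ 1 ℕ.+ (1 ℕ.+ j ℕ.* 2) ℕ.* 2 → Config n
    case-4j+3 0 refl = config₃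
    case-4j+3 1 refl = config₇
    case-4j+3 j@(suc (suc _)) n≡ =
      quadruple-1 (rec (suc j) 3+ (room 4 1 (suc j) (s≤s (s≤s z≤n)) eq (s≤s z≤n))) 3+ eq
      where
      eq : n ℕ.+ 1 ≡ 4 ℕ.* suc j
      eq = trans (cong (ℕ._+ 1) n≡) (e j)
        where
        e : ∀ j → 1 ℕ.+ (1 ℕ.+ j ℕ.* 2) ℕ.* 2 ℕ.+ 1 ≡ 4 ℕ.* suc j
        e = ℕ-Solver.solve-∀

  step : ∀ n → (∀ m → 3 ℕ.≤ m → 2 ℕ.* m ℕ.≤ n ℕ.+ 2 → Config m) → 3 ℕ.≤ n → Config n
  step n rec 3≤n with n divMod 2
  ... | result q 0F n≡ with q divMod 3
  ...   | result j 0F refl = case-6j rec 3≤n j n≡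
  ...   | result j 1F refl = case-6j+2 rec 3≤n j n≡
  ...   | result j 2F refl = case-6j+4 rec 3≤n j n≡
  step n rec 3≤n | result q 1F n≡ with q divMod 2
  ...   | result j 0F refl = case-4j+1 rec 3≤n j n≡
  ...   | result j 1F refl = case-4j+3 rec 3≤n j n≡

-- Closing stage n modulo p = 2n + 1.

TradeWithin : (p : ℕ) .{{_ : NonZero p}} → ℕ → Set
TradeWithin p bound = Σ[ R ∈ Subset p ] Σ[ φ ∈ PermutationOf R ]
  Nonempty R × Subset.∣ R ∣ ≤ bound × IsOrthogonalTrade p 1 2 (rows R) (permutedRows R φ)

-- Injectivity is asked only on `P`, since `residue` separates integers only within a bounded range.
Unique-map : ∀ {A B : Set} {P : A → Set} (f : A → B) → (∀ {x y} → P x → P y → f x ≡ f y → x ≡ y) →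
             ∀ {xs} → All P xs → Unique xs → Unique (map f xs)
Unique-map f inj []         []          = []
Unique-map f inj (px ∷ pxs) (x∉ ∷ !xs) =
  All.map⁺ (All.zipWith (λ (py , x≢y) eq → x≢y (inj px py eq)) (pxs , x∉)) ∷ Unique-map f inj pxs !xs

module Close (n : ℕ) (3≤n : 3 ≤ n) (p : ℕ) .{{_ : NonZero p}} (p≡1+2n : p ≡ 1 ℕ.+ n ℕ.* 2) where

  open Grow (config n 3≤n) 3≤n

  p≡ : + p ≡ + 2 * m + 1ℤ
  p≡ = trans (cong +_ (trans p≡1+2n (eq n))) (cong (_+ 1ℤ) (ℤ.pos-* 2 n))
    where
    eq : ∀ n → 1 ℕ.+ n ℕ.* 2 ≡ 2 ℕ.* n ℕ.+ 1
    eq = ℕ-Solver.solve-∀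

  -- Modulo 2n + 1 the point n is the midpoint of 0 and -1, and -n that of 0 and 1, while 0 is the
  -- midpoint of ±n. The order of the edges depends on the unit, so that the first edges supply s
  -- and the second -s.
  caps : ∀ {s} → IsUnit s → List (Vertex ℤ)
  caps (inj₁ _) = vertex 0ℤ (- m) m ∷ vertex m 0ℤ -1ℤ ∷ vertex (- m) 1ℤ 0ℤ ∷ []
  caps (inj₂ _) = vertex 0ℤ (- m) m ∷ vertex m -1ℤ 0ℤ ∷ vertex (- m) 0ℤ 1ℤ ∷ []

  cap cycle : List (Vertex ℤ)
  cap = caps s-unit
  cycle = cap ++ vertices

  -- The new defect is 0 in place of 0, which cancels and leaves no defect.
  exchange₁ : ∀ {s} (u : IsUnit s) →
    m ∷ 0ℤ ∷ map out₁ (caps u) ↭ s ∷ 0ℤ ∷ map at (caps u)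
  exchange₁ (inj₁ refl) = reorder (m ∷ - m ∷ 0ℤ ∷ 1ℤ ∷ []) (0 ∷ 2 ∷ 1 ∷ 2 ∷ 3 ∷ []) (3 ∷ 2 ∷ 2 ∷ 0 ∷ 1 ∷ [])
  exchange₁ (inj₂ refl) = reorder (m ∷ - m ∷ 0ℤ ∷ -1ℤ ∷ []) (0 ∷ 2 ∷ 1 ∷ 3 ∷ 2 ∷ []) (3 ∷ 2 ∷ 2 ∷ 0 ∷ 1 ∷ [])

  exchange₂ : ∀ {s} (u : IsUnit s) →
    - m ∷ 0ℤ ∷ map out₂ (caps u) ↭ - s ∷ 0ℤ ∷ map at (caps u)
  exchange₂ (inj₁ refl) = reorder (m ∷ - m ∷ 0ℤ ∷ -1ℤ ∷ []) (1 ∷ 2 ∷ 0 ∷ 3 ∷ 2 ∷ []) (3 ∷ 2 ∷ 2 ∷ 0 ∷ 1 ∷ [])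
  exchange₂ (inj₂ refl) = reorder (m ∷ - m ∷ 0ℤ ∷ 1ℤ ∷ []) (1 ∷ 2 ∷ 0 ∷ 2 ∷ 3 ∷ []) (3 ∷ 2 ∷ 2 ∷ 0 ∷ 1 ∷ [])

  at≡ : ∀ {s} (u : IsUnit s) → map at (caps u) ≡ 0ℤ ∷ m ∷ - m ∷ []
  at≡ (inj₁ _) = refl
  at≡ (inj₂ _) = refl

  at-cycle : map at cycle ≡ 0ℤ ∷ m ∷ - m ∷ map at vertices
  at-cycle = trans (map-++ at cap vertices) (cong (_++ map at vertices) (at≡ s-unit))

  at↭out₁ : map at cycle ↭ map out₁ cycle
  at↭out₁ = ↭-sym (drop-∷ (append-in out₁ cap (exchange₁ s-unit) (Network.in₁ network)))

  at↭out₂ : map at cycle ↭ map out₂ cycle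
  at↭out₂ = ↭-sym (drop-∷ (append-in out₂ cap (exchange₂ s-unit) (Network.in₂ network)))

  heads↭ : m ∷ - m ∷ 0ℤ ∷ map at vertices ↭ 0ℤ ∷ m ∷ - m ∷ map at vertices
  heads↭ = shift 0ℤ (m ∷ - m ∷ []) (map at vertices)

  unique-cycle : Unique (map at cycle)
  unique-cycle = subst Unique (sym at-cycle) (Unique-resp-↭ heads↭ Unique-heads)

  small : All (λ x → ∣ x ∣ ≤ n) (map at cycle)
  small = subst (All _) (sym at-cycle) (All-resp-↭ heads↭ ∣heads∣≤n′)

  _≈ₚ_ : ℤ → ℤ → Set
  _≈ₚ_ = _≈_ {p}

  -- Such integers differ by at most 2n = p - 1.
  residue-small : ∀ {x y} → ∣ x ∣ ≤ n → ∣ y ∣ ≤ n → residue {p} x ≡ residue y → x ≡ y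
  residue-small {x} {y} x≤ y≤ eq = ≈-small (residue-injective eq) (begin-strict
    ∣ x - y ∣        ≤⟨ ℤ.∣i-j∣≤∣i∣+∣j∣ x y ⟩
    ∣ x ∣ ℕ.+ ∣ y ∣  ≤⟨ ℕ.+-mono-≤ x≤ y≤ ⟩
    n ℕ.+ n          <⟨ ℕ.≤-refl ⟩
    suc (n ℕ.+ n)    ≡⟨ e n ⟩
    1 ℕ.+ n ℕ.* 2    ≡⟨ p≡1+2n ⟨
    p                ∎)
    where
    open ℕ.≤-Reasoning
    e : ∀ n → suc (n ℕ.+ n) ≡ 1 ℕ.+ n ℕ.* 2
    e = ℕ-Solver.solve-∀

  Balancedₚ : Vertex ℤ → Set
  Balancedₚ v = (out₁ v + out₂ v) ≈ₚ (at v + at v)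

  balanced-caps : ∀ {s} (u : IsUnit s) → All Balancedₚ (caps u)
  balanced-caps (inj₁ _) = ≡⇒≈ (ℤ.+-inverseˡ m)
    ∷ (-1ℤ , trans (e₁ m) (cong (λ q → m + m + -1ℤ * q) (sym p≡)))
    ∷ (1ℤ , trans (e₂ m) (cong (λ q → - m + - m + 1ℤ * q) (sym p≡))) ∷ []
    where
    e₁ : ∀ m → 0ℤ + -1ℤ ≡ m + m + -1ℤ * (+ 2 * m + 1ℤ)
    e₁ = solve-∀
    e₂ : ∀ m → 1ℤ + 0ℤ ≡ - m + - m + 1ℤ * (+ 2 * m + 1ℤ)
    e₂ = solve-∀
  balanced-caps (inj₂ _) = ≡⇒≈ (ℤ.+-inverseˡ m)
    ∷ (-1ℤ , trans (e₁ m) (cong (λ q → m + m + -1ℤ * q) (sym p≡)))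
    ∷ (1ℤ , trans (e₂ m) (cong (λ q → - m + - m + 1ℤ * q) (sym p≡))) ∷ []
    where
    e₁ : ∀ m → -1ℤ + 0ℤ ≡ m + m + -1ℤ * (+ 2 * m + 1ℤ)
    e₁ = solve-∀
    e₂ : ∀ m → 0ℤ + 1ℤ ≡ - m + - m + 1ℤ * (+ 2 * m + 1ℤ)
    e₂ = solve-∀

  closedTrade : TradeWithin p (length (map (mapVertex (residue {p})) cycle))
  -- p + 1 = 2(n + 1), so `suc n` is the inverse of 2.
  closedTrade = orthogonalTrade (suc n) (trans (cong (_+ 1ℤ) p≡) (e m)) (map (mapVertex residue) cycle)
    (subst Unique (sym (map-proj residue at (λ _ → refl) cycle))
      (Unique-map residue residue-small small unique-cycle))
    (subst₂ _↭_ (sym (map-proj residue at (λ _ → refl) cycle))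
      (sym (map-proj residue out₁ (λ _ → refl) cycle)) (map⁺ residue at↭out₁))
    (subst₂ _↭_ (sym (map-proj residue at (λ _ → refl) cycle))
      (sym (map-proj residue out₂ (λ _ → refl) cycle)) (map⁺ residue at↭out₂))
    (All.map⁺ (All.map (λ {v} eq → trans (residue-⊕ (out₁ v) (out₂ v))
        (trans (residue-cong eq) (sym (residue-⊕ (at v) (at v)))))
      (All.++⁺ (balanced-caps s-unit) (All.map ≡⇒≈ (Network.balanced network)))))
    (moving s-unit)
    where
    e : ∀ m → (+ 2 * m + 1ℤ) + 1ℤ ≡ + 2 * (1ℤ + m)
    e = solve-∀
    -m≢0 : residue {p} (- m) ≢ residue 0ℤ
    -m≢0 eq = ∣x∣≡n′⇒x≢0 ∣-m∣≡n′ (residue-small { - m} { 0ℤ} (ℕ.≤-reflexive ∣-m∣≡n′) z≤n eq)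
    -- In both caps the first edge from 0 leads to -n, so the set of moved rows is nonempty.
    moving : ∀ {s} (u : IsUnit s) →
             Any (λ v → out₁ v ≢ at v) (map (mapVertex (residue {p})) (caps u ++ vertices))
    moving (inj₁ _) = here -m≢0
    moving (inj₂ _) = here -m≢0

  -- Passing from n to p > 2n raises the logarithm by at least one, which absorbs the three caps.
  length-cycle : length (map (mapVertex (residue {p})) cycle) ≤ 8 ℕ.* ⌊log₂ p ⌋
  length-cycle = begin
    length (map (mapVertex (residue {p})) cycle)  ≡⟨ length-map (mapVertex residue) cycle ⟩
    length (cap ++ vertices)                      ≡⟨ length-++ cap ⟩
    length cap ℕ.+ length vertices                ≡⟨ cong (ℕ._+ length vertices) (length-caps s-unit) ⟩
    3 ℕ.+ length vertices                         ≤⟨ ℕ.+-mono-≤ (ℕ.m≤m+n 3 5) (ℕ.≤-trans size (ℕ.*-monoˡ-≤ ⌊log₂ n ⌋ (ℕ.m≤m+n 5 3))) ⟩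
    8 ℕ.+ 8 ℕ.* ⌊log₂ n ⌋                         ≡⟨ ℕ.*-suc 8 ⌊log₂ n ⌋ ⟨
    8 ℕ.* suc ⌊log₂ n ⌋                           ≡⟨ cong (8 ℕ.*_) (⌊log₂[2*b]⌋≡1+⌊log₂b⌋ n {{ℕ.>-nonZero 1≤n′}}) ⟨
    8 ℕ.* ⌊log₂ 2 ℕ.* n ⌋                         ≤⟨ ℕ.*-monoʳ-≤ 8 (⌊log₂⌋-mono-≤ 2n≤p) ⟩
    8 ℕ.* ⌊log₂ p ⌋                               ∎
    where
    open ℕ.≤-Reasoning
    length-caps : ∀ {s} (u : IsUnit s) → length (caps u) ≡ 3
    length-caps (inj₁ _) = refl
    length-caps (inj₂ _) = refl
    2n≤p : 2 ℕ.* n ≤ p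
    2n≤p = ℕ.≤-trans (ℕ.≤-reflexive (ℕ.*-comm 2 n)) (ℕ.≤-trans (ℕ.n≤1+n (n ℕ.* 2)) (ℕ.≤-reflexive (sym p≡1+2n)))

-- The primes 3 and 5, and the conclusion.

relax : ∀ {p a b} .{{_ : NonZero p}} → a ≤ b → TradeWithin p a → TradeWithin p b
relax a≤b (R , φ , nonempty , ∣R∣≤a , trade) = R , φ , nonempty , ℕ.≤-trans ∣R∣≤a a≤b , trade

-- For p = 3 and p = 5 the number n = (p - 1)/2 is below the first stage. There all rows are traded
-- by σ r = r + 1, for which 2r - σ r = r - 1 is again a permutation.
trade₃ : TradeWithin 3 3
trade₃ = orthogonalTrade 2 refl
  (vertex 0F 1F 2F ∷ vertex 1F 2F 0F ∷ vertex 2F 0F 1F ∷ [])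
  (from-yes (DecUnique.unique? _≟_ (0F ∷ 1F ∷ 2F ∷ [])))
  (to-witness-T (permute? _≟_ (0F ∷ 1F ∷ 2F ∷ []) (1F ∷ 2F ∷ 0F ∷ [])) _)
  (to-witness-T (permute? _≟_ (0F ∷ 1F ∷ 2F ∷ []) (2F ∷ 0F ∷ 1F ∷ [])) _)
  (refl ∷ refl ∷ refl ∷ [])
  (here λ ())

trade₅ : TradeWithin 5 5
trade₅ = orthogonalTrade 3 refl
  (vertex 0F 1F 4F ∷ vertex 1F 2F 0F ∷ vertex 2F 3F 1F ∷ vertex 3F 4F 2F ∷ vertex 4F 0F 3F ∷ [])
  (from-yes (DecUnique.unique? _≟_ (0F ∷ 1F ∷ 2F ∷ 3F ∷ 4F ∷ [])))
  (to-witness-T (permute? _≟_ (0F ∷ 1F ∷ 2F ∷ 3F ∷ 4F ∷ []) (1F ∷ 2F ∷ 3F ∷ 4F ∷ 0F ∷ [])) _)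
  (to-witness-T (permute? _≟_ (0F ∷ 1F ∷ 2F ∷ 3F ∷ 4F ∷ []) (4F ∷ 0F ∷ 1F ∷ 2F ∷ 3F ∷ [])) _)
  (refl ∷ refl ∷ refl ∷ refl ∷ refl ∷ [])
  (here λ ())

theorem5p2 : ∃[ C ] C > 0 ×
    (∀ (p : ℕ) .{{_ : NonZero p}} → Prime p → 2 ∤ p →
    Σ[ R ∈ Subset p ] Σ[ φ ∈ PermutationOf R ]
    Nonempty R ×
    Subset.∣ R ∣ ≤ C ℕ.* ⌊log₂ p ⌋ ×
    IsOrthogonalTrade p 1 2 (rows R) (permutedRows R φ))
theorem5p2 = 8 , s≤s z≤n , λ p p-prime odd → trade p p-prime odd (p divMod 2)
  where
  trade : ∀ p .{{_ : NonZero p}} → Prime p → 2 ∤ p → DivMod p 2 → TradeWithin p (8 ℕ.* ⌊log₂ p ⌋)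
  trade p p-prime odd (result q 0F p≡2q) = contradiction (divides q p≡2q) odd
  trade p p-prime odd (result 0 1F refl) = contradiction p-prime ¬prime[1]
  trade p p-prime odd (result 1 1F refl) = relax {3} (ℕ.m≤m+n 3 5) trade₃
  trade p p-prime odd (result 2 1F refl) = relax {5} (ℕ.m≤m+n 5 11) trade₅
  trade p p-prime odd (result n@(suc (suc (suc _))) 1F p≡1+2n) = relax length-cycle closedTrade
    where open Close n (s≤s (s≤s (s≤s z≤n))) p p≡1+2n
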